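{- For every $\nu\in(0,1)$, every oblivious $\nu$-reliable spanner for the unweighted path graph $P_n$ has lightness $\Omega(\nu^{ -2}\cdot\log (n\nu))$. (This is for any finite stretch; indeed it holds even if the spanner is only required to preserve connectivity.)
   Context: The hidden constant in $\Omega(\cdot)$ is universal; logarithms are base 2. $P_n$ is the path on vertex set $X=[n]=\{1,\dots,n\}$ with unit weight edges $\{i,i+1\}$, and $d_X(i,j)=|i-j|$. For a weighted graph $H$ on vertex set $X$, $d_H$ is its shortest path distance, and $H$ is dominating if $d_X(u,v)\le d_H(u,v)$ for all $u,v$. An oblivious $\nu$-reliable spanner, in the sense used here (connectivity only, which is implied by any finite stretch), is a probability distribution $\mathcal{D}$ over dominating weighted graphs on $X$ such that for every attack set $B\subseteq X$ and every $H\in\mathrm{supp}(\mathcal{D})$ there is a superset $B_H^+\supseteq B$ such that all points of $X\setminus B_H^+$ belong to the same connected component of $H\setminus B=H[X\setminus B]$, and $\mathbb{E}_{H\sim\mathcal{D}}[|B_H^+|]\le(1+\nu)|B|$. (An oblivious $\nu$-reliable $t$-spanner requires instead $d_{H[X\setminus B]}(x,y)\le t\cdot d_X(x,y)$ for all $x,y\notin B_H^+$.) $\mathcal{D}$ has lightness $\phi$ if every $H\in\mathrm{supp}(\mathcal{D})$ has lightness $w(H)/w(\mathrm{MST}(X))$ at most $\phi$, where $w(H)$ is the total edge weight of $H$ and $\mathrm{MST}(X)$ is a minimum spanning tree of $(X,d_X)$ (here of weight $n-1$); the lower bound says any such $\phi$ is $\Omega(\nu^{ -2}\log(n\nu))$.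 -}

module Defs where

open import Algebra.Apartness.Bundles using (HeytingField; HeytingCommutativeRing)
open import Algebra.Bundles using (CommutativeRing; Semiring)
import Algebra.Definitions.RawSemiring as RawSemiringDefinitions
open import Data.Bool.Base using (Bool; true; false; T; _∧_; if_then_else_)
open import Data.Fin.Base using (Fin; zero; suc; toℕ; inject₁; fromℕ)
open import Data.Fin.Subset using (Subset; _⊆_; _∉_; ∣_∣)
open import Data.Nat.Base as ℕ using (ℕ; _<ᵇ_)
open import Data.Product.Base using (_×_; ∃-syntax; Σ-syntax; proj₁)
open import Data.Sum.Base using (_⊎_; inj₂)
open import Function.Definitions using (Injective)
open import Level using (0ℓ)
open import Relation.Binary.Construct.Closure.ReflexiveTransitive using (Star; ε; _◅_)
open import Relation.Binary.PropositionalEquality.Core using (_≡_)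
open import Relation.Binary.Structures using (IsStrictPartialOrder)
open import Relation.Nullary.Negation.Core using (¬_)

-- The real numbers, as a Cauchy complete Archimedean ordered field.  The
-- axioms are the constructive ones: the strict order is cotransitive rather
-- than decidable.  They hold for Bishop's reals, and classically they
-- determine ℝ up to isomorphism.

record RealNumbers : Set₁ where
  infix 4 _<_ _≤_

  field
    heytingField : HeytingField 0ℓ 0ℓ 0ℓ

  open HeytingField heytingField public

  field
    _<_                    : Carrier → Carrier → Set
    <-isStrictPartialOrder : IsStrictPartialOrder _≈_ _<_
    <-cotrans              : ∀ {x y} → x < y → ∀ z → (x < z) ⊎ (z < y)
    #⇒<⊎>                  : ∀ {x y} → x # y → (x < y) ⊎ (y < x)
    <⊎>⇒#                  : ∀ {x y} → (x < y) ⊎ (y < x) → x # y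
    +-monoˡ-<              : ∀ {x y} z → x < y → x + z < y + z
    *-pos                  : ∀ {x y} → 0# < x → 0# < y → 0# < x * y

  _≤_ : Carrier → Carrier → Set
  x ≤ y = ¬ (y < x)

  commutativeRing : CommutativeRing 0ℓ 0ℓ
  commutativeRing = HeytingCommutativeRing.commutativeRing heytingCommutativeRing

  open RawSemiringDefinitions (Semiring.rawSemiring (CommutativeRing.semiring commutativeRing))
    public using (_^_; sum)
    renaming (_×_ to _·_)

  fromNat : ℕ → Carrier
  fromNat n = n · 1#

  field
    archimedean : ∀ x → ∃[ n ] x < fromNat n
    complete    : ∀ (s : ℕ → Carrier) →
      (∀ δ → 0# < δ → ∃[ N ] (∀ j k → N ℕ.≤ j → N ℕ.≤ k → s j < s k + δ)) →
      ∃[ l ] (∀ δ → 0# < δ →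
        ∃[ N ] (∀ k → N ℕ.≤ k → (s k < l + δ) × (l < s k + δ)))

  recip : ∀ x → 0# < x → Carrier
  recip x 0<x = proj₁ (#⇒invertible (<⊎>⇒# (inj₂ 0<x)))

  -- 2 ^ L = x, where the power with real exponent is determined by the powers
  -- with rational exponents r = (a - b) / q, q > 0:
  -- r < L implies 2 ^ r < x, and L < r implies x < 2 ^ r.
  IsLog₂ : Carrier → Carrier → Set
  IsLog₂ x L = ∀ (a b q : ℕ) → 0 ℕ.< q →
      (fromNat a < fromNat b + fromNat q * L →
        fromNat 2 ^ a < fromNat 2 ^ b * x ^ q)
    × (fromNat b + fromNat q * L < fromNat a →
        fromNat 2 ^ b * x ^ q < fromNat 2 ^ a)

record Graph (n : ℕ) : Set where
  field
    adj        : Fin n → Fin n → Bool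
    adj-sym    : ∀ u v → adj u v ≡ adj v u
    adj-irrefl : ∀ u → adj u u ≡ false

  Edge : Fin n → Fin n → Set
  Edge u v = T (adj u v)

  Walk : Fin n → Fin n → Set
  Walk = Star Edge

  -- Joined by a walk in the subgraph induced on the complement of B.
  ConnectedOutside : Subset n → Fin n → Fin n → Set
  ConnectedOutside B = Star (λ u v → Edge u v × u ∉ B × v ∉ B)

  Connected : Set
  Connected = ∀ u v → Walk u v

  Cycle : Set
  Cycle = ∃[ k ] Σ[ c ∈ (Fin (3 ℕ.+ k) → Fin n) ]
      Injective _≡_ _≡_ c
    × (∀ (i : Fin (2 ℕ.+ k)) → Edge (c (inject₁ i)) (c (suc i)))
    × Edge (c (fromℕ (2 ℕ.+ k))) (c zero)

  IsSpanningTree : Set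
  IsSpanningTree = Connected × ¬ Cycle

module Spanners (ℝ : RealNumbers) where
  open RealNumbers ℝ

  -- The sum counts each edge once, from its smaller endpoint.
  totalWeight : ∀ {n} → Graph n → (Fin n → Fin n → Carrier) → Carrier
  totalWeight G w = sum λ u → sum λ v →
    if (toℕ u <ᵇ toℕ v) ∧ Graph.adj G u v then w u v else 0#

  -- The values of weight on non-adjacent pairs are irrelevant.
  record WeightedGraph (n : ℕ) : Set where
    field
      graph         : Graph n
      weight        : Fin n → Fin n → Carrier
      weight-sym    : ∀ u v → weight u v ≈ weight v u
      weight-nonneg : ∀ u v → Graph.Edge graph u v → 0# ≤ weight u v

    open Graph graph public

    walkLength : ∀ {u v} → Walk u v → Carrier
    walkLength ε                         = 0#
    walkLength (_◅_ {i = u} {j = v} _ p) = weight u v + walkLength p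

    total : Carrier
    total = totalWeight graph weight

  -- The shortest path metric of the path graph; Fin n stands for {1,…,n}.
  dX : ∀ {n} → Fin n → Fin n → Carrier
  dX u v = fromNat ℕ.∣ toℕ u - toℕ v ∣

  -- d_X ≤ d_H, where d_H u v is the infimum of the lengths of the walks from
  -- u to v in H (infinite if there are none).
  Dominating : ∀ {n} → WeightedGraph n → Set
  Dominating H = ∀ u v (p : Walk u v) → dX u v ≤ walkLength p
    where open WeightedGraph H

  IsMST : ∀ {n} → Graph n → Set
  IsMST {n} S = Graph.IsSpanningTree S ×
    (∀ (S′ : Graph n) → Graph.IsSpanningTree S′ →
       totalWeight S dX ≤ totalWeight S′ dX)

  -- A probability space, given by its expectation: a normalised, monotone
  -- linear functional on a space of real random variables.  Integration
  -- against any probability measure is of this form; countable additivity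
  -- is not required.
  record ProbabilitySpace : Set₁ where
    field
      Ω                : Set
      Integrable       : (Ω → Carrier) → Set
      integrable-const : ∀ a → Integrable (λ _ → a)
      integrable-+     : ∀ {X Y} → Integrable X → Integrable Y →
                     Integrable (λ ω → X ω + Y ω)
      integrable-*     : ∀ a {X} → Integrable X → Integrable (λ ω → a * X ω)
      𝔼                : ∀ {X} → Integrable X → Carrier
      𝔼-const          : ∀ a → 𝔼 (integrable-const a) ≈ a
      𝔼-+              : ∀ {X Y} (x : Integrable X) (y : Integrable Y) →
                     𝔼 (integrable-+ x y) ≈ 𝔼 x + 𝔼 y
      𝔼-*              : ∀ a {X} (x : Integrable X) →
                     𝔼 (integrable-* a x) ≈ a * 𝔼 x
      𝔼-mono           : ∀ {X Y} (x : Integrable X) (y : Integrable Y) →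
                     (∀ ω → X ω ≤ Y ω) → 𝔼 x ≤ 𝔼 y

  -- A distribution over dominating weighted graphs, as the law of a random
  -- graph.  Its support is the range of H: a distribution D with support S
  -- is given by Ω = S and H the inclusion.
  record GraphDistribution (n : ℕ) : Set₁ where
    field
      space      : ProbabilitySpace
    open ProbabilitySpace space public
    field
      H          : Ω → WeightedGraph n
      dominating : ∀ ω → Dominating (H ω)

  ObliviousReliable : ∀ {n} → Carrier → GraphDistribution n → Set
  ObliviousReliable {n} ν D = ∀ (B : Subset n) →
    Σ[ B⁺ ∈ (Ω → Subset n) ]
        (∀ ω → B ⊆ B⁺ ω)
      × (∀ ω u v → u ∉ B⁺ ω → v ∉ B⁺ ω →
           WeightedGraph.ConnectedOutside (H ω) B u v)
      × (Σ[ i ∈ Integrable (λ ω → fromNat ∣ B⁺ ω ∣) ]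
           𝔼 i ≤ (1# + ν) * fromNat ∣ B ∣)
    where open GraphDistribution D

  -- The ratio w(H) / w(MST) is at most φ, with the denominator cleared; this
  -- is meaningful for n ≥ 2, when w(MST) is positive.
  HasLightness : ∀ {n} → GraphDistribution n → Carrier → Set
  HasLightness {n} D φ = Σ[ S ∈ Graph n ] IsMST S ×
    (∀ ω → WeightedGraph.total (H ω) ≤ φ * totalWeight S dX)
    where open GraphDistribution D

module Submission where

-- Fix a scale: cut the path into blocks of k ≈ 1/ν slots of length t followed by
-- a gap of length g, and let B consist of everything except one slot per block,
-- chosen independently at random.  The survivors number about n/k, so νn is a
-- small fraction of them and most surviving slots must be joined by an edge to
-- another surviving slot.  Such an edge is longer than g, and a given edge
-- survives with probability at most 1/k², hence H has about k² · n/(kt) edges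
-- longer than g.  With t = 2ʲ and g = k2ʲ, each of the log (nν) scales thus forces
-- weight about k²n, and an edge of length d is charged only O(d) in total,
-- because the scales below d form a geometric series.
-- Since only |B⁺| is known to be integrable, all estimates are made pointwise and
-- summed over the finitely many attacks before expectations are taken.

open import Defs
open import Algebra.Bundles using (CommutativeRing)
import Algebra.Properties.Ring
import Algebra.Properties.Semiring.Mult
import Algebra.Solver.Ring.NaturalCoefficients.Default
open import Data.Bool.Base using (true; false; T; _∧_; _∨_; if_then_else_)
open import Data.Bool.Properties using (T?; ∨-comm; T-∨)
open import Data.Fin.Base using (Fin; zero; suc; toℕ; inject₁; fromℕ)
open import Data.Fin.Induction using (<-weakInduction)
open import Data.Fin.Properties using (toℕ<n; any?; toℕ-inject₁; toℕ-injective; toℕ-fromℕ)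
open import Data.Fin.Subset using (Subset; _∈_; _∉_; _⊆_; ∣_∣)
open import Data.Fin.Subset.Properties using (_∈?_)
open import Data.List.Base using (List; []; _∷_; map; allFin; upTo; length; cartesianProductWith; _++_)
open import Data.List.Properties using (map-cong; map-∘; map-tabulate; map-upTo)
open import Data.Nat.Base as ℕ using (ℕ; zero; suc; NonZero; _<ᵇ_; _≡ᵇ_)
open import Data.Nat.Divisibility using (n∣m*n)
open import Data.Nat.DivMod using
  ( _/_; _%_; m/n*n≤m; m≡m%n+[m/n]*n; m%n<n; m*n/n≡m; m<n⇒m/n≡0; m<n⇒m%n≡m; [m+kn]%n≡m%n
  ; +-distrib-/-∣ˡ )
import Data.Nat.Properties as ℕ
open import Data.Nat.Tactic.RingSolver using (solve-∀)
open import Data.Product.Base using (_×_; _,_; proj₁; proj₂; ∃-syntax; Σ-syntax)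
open import Data.Sum.Base using (_⊎_; inj₁; inj₂; swap)
open import Data.Unit.Base using (tt)
open import Data.Vec.Base using ([]; _∷_; there; tabulate)
open import Data.Vec.Properties using (lookup∘tabulate; []=⇒lookup; lookup⇒[]=)
open import Function.Base using (_∘_; id)
open import Function.Bundles using (Equivalence)
open import Function.Definitions using (Injective)
open import Relation.Binary.Construct.Closure.ReflexiveTransitive using (ε; _◅_; _◅◅_; reverse)
open import Relation.Binary.Definitions using (tri<; tri≈; tri>)
open import Relation.Binary.PropositionalEquality as ≡ using (_≡_; _≢_)
import Relation.Binary.Reasoning.Base.Triple
open import Relation.Binary.Structures using (IsStrictPartialOrder; IsPreorder)
open import Relation.Nullary using (Dec; yes; no; does; ¬_; ¬?; contradiction; _×-dec_)

-- The number `k` must meet two opposite demands. At least `n / 4k` vertices survive, and the budget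
-- `νn` must be a small part of them, whence `16kν ≤ 1`; but a weight of order `k²n` per scale
-- yields `ν⁻²` only if `k` is also at least a constant times `1/ν`. For `ν` close to 1 no `k ≥ 1`
-- meets the first demand. There `k = 1`: nothing is random, and the slots are 16 times as long as
-- the gaps, so that `(1 + ν)|B|` stays below `n`.
--
-- The order of the reals is not decidable, so `1/ν` cannot be rounded; two overlapping tests on
-- `k`, told apart by cotransitivity, replace rounding.
--
-- For large `ν` the logarithm exceeds the number of scales by a constant, and there may be no scale
-- at all. The empty attack fills this gap: it forces weight of order `n`. It also shows `0 ≤ φ`,
-- which is required for replacing the weight of the minimum spanning tree by its upper bound `n`.
--
-- Probabilities are counts over `k ^ n` outcomes with all denominators cleared, so the
-- combinatorics takes place in the natural numbers, without division or subtraction in the main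
-- inequalities.

module Combinatorics where
  open import Data.Nat.Base using (_+_; _*_; _^_; _∸_; _≤_; _<_; z≤n; s≤s; z<s; ∣_-_∣)
  open import Data.Nat.ListAction using (sum)
  open import Data.Nat.Properties
  open ≡ using (refl; sym; trans; cong; cong₂; subst)

  private
    variable
      I I′ I″ : Set
      Φ Ψ : Set

  -- Indicators and finite sums of natural numbers.

  [_] : Dec Φ → ℕ
  [ yes _ ] = 1
  [ no  _ ] = 0

  []≤1 : (p : Dec Φ) → [ p ] ≤ 1
  []≤1 (yes _) = ≤-refl
  []≤1 (no  _) = z≤n

  []-true : (p : Dec Φ) → Φ → [ p ] ≡ 1
  []-true (yes _) _ = refl
  []-true (no ¬p) p = contradiction p ¬p

  []-false : (p : Dec Φ) → ¬ Φ → [ p ] ≡ 0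
  []-false (yes p) ¬p = contradiction p ¬p
  []-false (no  _) _  = refl

  []≤ : (p : Dec Φ) {x : ℕ} → (Φ → 1 ≤ x) → [ p ] ≤ x
  []≤ (yes p) f = f p
  []≤ (no  _) f = z≤n

  []≥1 : (p : Dec Φ) → Φ → 1 ≤ [ p ]
  []≥1 p x = ≤-reflexive (sym ([]-true p x))

  []-mono : (p : Dec Φ) (q : Dec Ψ) → (Φ → Ψ) → [ p ] ≤ [ q ]
  []-mono p q f = []≤ p ([]≥1 q ∘ f)

  ∑ : List I → (I → ℕ) → ℕ
  ∑ xs F = sum (map F xs)

  ∑-mono : ∀ (xs : List I) {F G : I → ℕ} → (∀ x → F x ≤ G x) → ∑ xs F ≤ ∑ xs G
  ∑-mono []       h = z≤n
  ∑-mono (x ∷ xs) h = +-mono-≤ (h x) (∑-mono xs h)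

  ∑-cong : ∀ (xs : List I) {F G : I → ℕ} → (∀ x → F x ≡ G x) → ∑ xs F ≡ ∑ xs G
  ∑-cong xs h = cong sum (map-cong h xs)

  ∑-+ : ∀ (xs : List I) {F G : I → ℕ} → ∑ xs (λ x → F x + G x) ≡ ∑ xs F + ∑ xs G
  ∑-+ []                 = refl
  ∑-+ (x ∷ xs) {F} {G} =
    trans (cong (F x + G x +_) (∑-+ xs)) (lemma (F x) (G x) (∑ xs F) (∑ xs G))
    where
    lemma : ∀ a b c d → a + b + (c + d) ≡ a + c + (b + d)
    lemma = solve-∀

  ∑-*ˡ : ∀ (xs : List I) c {F : I → ℕ} → ∑ xs (λ x → c * F x) ≡ c * ∑ xs F
  ∑-*ˡ []       c     = sym (*-zeroʳ c)
  ∑-*ˡ (x ∷ xs) c {F} =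
    trans (cong (c * F x +_) (∑-*ˡ xs c)) (sym (*-distribˡ-+ c (F x) (∑ xs F)))

  ∑-*ʳ : ∀ (xs : List I) c {F : I → ℕ} → ∑ xs (λ x → F x * c) ≡ ∑ xs F * c
  ∑-*ʳ xs c {F} = trans (∑-cong xs (λ x → *-comm (F x) c)) (trans (∑-*ˡ xs c) (*-comm c (∑ xs F)))

  ∑-const : ∀ (xs : List I) c → ∑ xs (λ _ → c) ≡ length xs * c
  ∑-const []       c = refl
  ∑-const (x ∷ xs) c = cong (c +_) (∑-const xs c)

  ∑-swap : ∀ (xs : List I) (ys : List I′) {F : I → I′ → ℕ} →
           ∑ xs (λ x → ∑ ys (F x)) ≡ ∑ ys (λ y → ∑ xs (λ x → F x y))
  ∑-swap []       ys = sym (trans (∑-const ys 0) (*-zeroʳ (length ys)))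
  ∑-swap (x ∷ xs) ys = trans (cong (_ +_) (∑-swap xs ys)) (sym (∑-+ ys))

  ∑-++ : ∀ (xs ys : List I) {F : I → ℕ} → ∑ (xs ++ ys) F ≡ ∑ xs F + ∑ ys F
  ∑-++ []       ys     = refl
  ∑-++ (x ∷ xs) ys {F} = trans (cong (F x +_) (∑-++ xs ys)) (sym (+-assoc (F x) _ _))

  ∑-map : ∀ (f : I → I′) (xs : List I) {F : I′ → ℕ} → ∑ (map f xs) F ≡ ∑ xs (F ∘ f)
  ∑-map f xs = cong sum (sym (map-∘ xs))

  ∑-product : ∀ (f : I → I′ → I″) (xs : List I) (ys : List I′) {F : I″ → ℕ} →
              ∑ (cartesianProductWith f xs ys) F ≡ ∑ xs (λ x → ∑ ys (λ y → F (f x y)))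
  ∑-product f []       ys = refl
  ∑-product f (x ∷ xs) ys =
    trans (∑-++ (map (f x) ys) _) (cong₂ _+_ (∑-map (f x) ys) (∑-product f xs ys))

  ∑-upTo-suc : ∀ n (F : ℕ → ℕ) → ∑ (upTo (suc n)) F ≡ F 0 + ∑ (upTo n) (F ∘ suc)
  ∑-upTo-suc n F = cong (F 0 +_) (trans (cong (λ xs → ∑ xs F) (sym (map-upTo suc n))) (∑-map suc (upTo n)))

  ∑-allFin-suc : ∀ n (F : Fin (suc n) → ℕ) → ∑ (allFin (suc n)) F ≡ F zero + ∑ (allFin n) (F ∘ suc)
  ∑-allFin-suc n F =
    cong (F zero +_) (trans (cong (λ xs → ∑ xs F) (sym (map-tabulate {n = n} id suc))) (∑-map suc (allFin n)))

  ∑-upTo-last : ∀ n {F : ℕ → ℕ} → ∑ (upTo (suc n)) F ≡ ∑ (upTo n) F + F n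
  ∑-upTo-last zero    {F} = +-identityʳ (F 0)
  ∑-upTo-last (suc n) {F} = begin-equality
    ∑ (upTo (2 + n)) F                            ≡⟨ ∑-upTo-suc (suc n) F ⟩
    F 0 + ∑ (upTo (suc n)) (F ∘ suc)              ≡⟨ cong (F 0 +_) (∑-upTo-last n) ⟩
    F 0 + (∑ (upTo n) (F ∘ suc) + F (suc n))      ≡⟨ +-assoc (F 0) _ _ ⟨
    F 0 + ∑ (upTo n) (F ∘ suc) + F (suc n)        ≡⟨ cong (_+ F (suc n)) (∑-upTo-suc n F) ⟨
    ∑ (upTo (suc n)) F + F (suc n)                ∎
    where open ≤-Reasoning

  ∑-upTo-+ : ∀ a b {F : ℕ → ℕ} → ∑ (upTo (a + b)) F ≡ ∑ (upTo a) F + ∑ (upTo b) (λ x → F (a + x))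
  ∑-upTo-+ zero    b     = refl
  ∑-upTo-+ (suc a) b {F} = begin-equality
    ∑ (upTo (suc a + b)) F                                               ≡⟨ ∑-upTo-suc (a + b) F ⟩
    F 0 + ∑ (upTo (a + b)) (F ∘ suc)                                     ≡⟨ cong (F 0 +_) (∑-upTo-+ a b) ⟩
    F 0 + (∑ (upTo a) (F ∘ suc) + ∑ (upTo b) (λ x → F (suc a + x)))      ≡⟨ +-assoc (F 0) _ _ ⟨
    F 0 + ∑ (upTo a) (F ∘ suc) + ∑ (upTo b) (λ x → F (suc a + x))        ≡⟨ cong (_+ ∑ (upTo b) (λ x → F (suc a + x))) (∑-upTo-suc a F) ⟨
    ∑ (upTo (suc a)) F + ∑ (upTo b) (λ x → F (suc a + x))                ∎
    where open ≤-Reasoning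

  ∑-upTo-mono : ∀ {a b} → a ≤ b → (F : ℕ → ℕ) → ∑ (upTo a) F ≤ ∑ (upTo b) F
  ∑-upTo-mono {a} a≤b F with m≤n⇒∃[o]m+o≡n a≤b
  ... | o , refl = subst (∑ (upTo a) F ≤_) (sym (∑-upTo-+ a o)) (m≤m+n _ _)

  -- Division with remainder by `b`: this sums along the path block by block.
  ∑-upTo-* : ∀ a b {F : ℕ → ℕ} →
             ∑ (upTo (a * b)) F ≡ ∑ (upTo a) (λ i → ∑ (upTo b) (λ x → F (i * b + x)))
  ∑-upTo-* zero    b     = refl
  ∑-upTo-* (suc a) b {F} = begin-equality
    ∑ (upTo (b + a * b)) F
      ≡⟨ ∑-upTo-+ b (a * b) ⟩
    ∑ (upTo b) F + ∑ (upTo (a * b)) (λ x → F (b + x))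
      ≡⟨ cong (∑ (upTo b) F +_) (∑-upTo-* a b) ⟩
    ∑ (upTo b) F + ∑ (upTo a) (λ i → ∑ (upTo b) (λ x → F (b + (i * b + x))))
      ≡⟨ cong (∑ (upTo b) F +_) (∑-cong (upTo a) λ i → ∑-cong (upTo b) λ x → cong F (sym (+-assoc b (i * b) x))) ⟩
    ∑ (upTo b) F + ∑ (upTo a) (λ i → ∑ (upTo b) (λ x → F (suc i * b + x)))
      ≡⟨ ∑-upTo-suc a (λ i → ∑ (upTo b) (λ x → F (i * b + x))) ⟨
    ∑ (upTo (suc a)) (λ i → ∑ (upTo b) (λ x → F (i * b + x))) ∎
    where open ≤-Reasoning

  ∑-upTo-const : ∀ n c → ∑ (upTo n) (λ _ → c) ≡ n * c
  ∑-upTo-const zero    c = refl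
  ∑-upTo-const (suc n) c = trans (∑-upTo-suc n (λ _ → c)) (cong (c +_) (∑-upTo-const n c))

  ∑-allFin-const : ∀ n c → ∑ (allFin n) (λ _ → c) ≡ n * c
  ∑-allFin-const zero    c = refl
  ∑-allFin-const (suc n) c = trans (∑-allFin-suc n (λ _ → c)) (cong (c +_) (∑-allFin-const n c))

  ∑-allFin-toℕ : ∀ n {F : ℕ → ℕ} → ∑ (allFin n) (F ∘ toℕ) ≡ ∑ (upTo n) F
  ∑-allFin-toℕ zero        = refl
  ∑-allFin-toℕ (suc n) {F} =
    trans (∑-allFin-suc n (F ∘ toℕ)) (trans (cong (F 0 +_) (∑-allFin-toℕ n)) (sym (∑-upTo-suc n F)))

  ≤∑-allFin : ∀ {n} (F : Fin n → ℕ) i → F i ≤ ∑ (allFin n) F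
  ≤∑-allFin {suc n} F zero    = subst (F zero ≤_) (sym (∑-allFin-suc n F)) (m≤m+n _ _)
  ≤∑-allFin {suc n} F (suc i) =
    subst (F (suc i) ≤_) (sym (∑-allFin-suc n F)) (≤-trans (≤∑-allFin (F ∘ suc) i) (m≤n+m _ _))

  ∣∣≡∑ : ∀ {n} (p : Subset n) → ∣ p ∣ ≡ ∑ (allFin n) (λ u → [ u ∈? p ])
  ∣∣≡∑ []              = refl
  ∣∣≡∑ {suc n} (s ∷ p) = trans (head s) (sym (∑-allFin-suc n (λ u → [ u ∈? (s ∷ p) ])))
    where
    ∈-suc : ∀ s u → [ u ∈? p ] ≡ [ suc u ∈? (s ∷ p) ]
    ∈-suc s u = ≤-antisym ([]-mono (u ∈? p) (suc u ∈? (s ∷ p)) there)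
                          ([]-mono (suc u ∈? (s ∷ p)) (u ∈? p) λ { (there h) → h })
    tail : ∀ s → ∣ p ∣ ≡ ∑ (allFin n) (λ u → [ suc u ∈? (s ∷ p) ])
    tail s = trans (∣∣≡∑ p) (∑-cong (allFin n) (∈-suc s))
    head : ∀ s → ∣ s ∷ p ∣ ≡ [ zero ∈? (s ∷ p) ] + ∑ (allFin n) (λ u → [ suc u ∈? (s ∷ p) ])
    head true  = cong suc (tail true)
    head false = tail false

  -- Used for the vertices of one slot and, with length 1, for the solutions of an equation `x ≡ a`.
  ∑-window : ∀ n c t → ∑ (upTo n) (λ x → [ (c ≤? x) ×-dec (x <? c + t) ]) ≤ t
  ∑-window zero    c       t       = z≤n
  ∑-window (suc n) (suc c) t       = begin
    ∑ (upTo (suc n)) W                   ≡⟨ ∑-upTo-suc n W ⟩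
    W 0 + ∑ (upTo n) (W ∘ suc)           ≡⟨ cong (_+ ∑ (upTo n) (W ∘ suc)) ([]-false ((suc c ≤? 0) ×-dec (0 <? suc c + t)) λ ()) ⟩
    ∑ (upTo n) (W ∘ suc)                 ≤⟨ ∑-mono (upTo n) (λ x → []-mono ((suc c ≤? suc x) ×-dec (suc x <? suc c + t)) ((c ≤? x) ×-dec (x <? c + t)) λ (p , q) → ℕ.s≤s⁻¹ p , ℕ.s≤s⁻¹ q) ⟩
    ∑ (upTo n) (λ x → [ (c ≤? x) ×-dec (x <? c + t) ]) ≤⟨ ∑-window n c t ⟩
    t                                    ∎
    where
    open ≤-Reasoning
    W = λ x → [ (suc c ≤? x) ×-dec (x <? suc c + t) ]
  ∑-window (suc n) zero    zero    =
    ≤-trans (∑-mono (upTo (suc n)) {G = λ _ → 0} (λ x → []≤ ((0 ≤? x) ×-dec (x <? 0)) λ ())) (≤-reflexive (trans (∑-upTo-const (suc n) 0) (*-zeroʳ (suc n))))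
  ∑-window (suc n) zero    (suc t) = begin
    ∑ (upTo (suc n)) W                   ≡⟨ ∑-upTo-suc n W ⟩
    W 0 + ∑ (upTo n) (W ∘ suc)           ≤⟨ +-monoˡ-≤ (∑ (upTo n) (W ∘ suc)) ([]≤1 ((0 ≤? 0) ×-dec (0 <? suc t))) ⟩
    suc (∑ (upTo n) (W ∘ suc))           ≤⟨ s≤s (∑-mono (upTo n) (λ x → []-mono ((0 ≤? suc x) ×-dec (suc x <? suc t)) ((0 ≤? x) ×-dec (x <? t)) λ (_ , q) → z≤n , ℕ.s≤s⁻¹ q)) ⟩
    suc (∑ (upTo n) (λ x → [ (0 ≤? x) ×-dec (x <? t) ])) ≤⟨ s≤s (∑-window n 0 t) ⟩
    suc t                                ∎
    where
    open ≤-Reasoning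
    W = λ x → [ (0 ≤? x) ×-dec (x <? suc t) ]

  -- The sample space of random slot choices.

  -- Taken with `n` entries, whatever the number `m ≤ n` of blocks, so that all scales share one
  -- space of `k ^ n` outcomes.
  choices : ∀ k → ℕ → List (List (Fin k))
  choices k zero    = [] ∷ []
  choices k (suc n) = cartesianProductWith _∷_ (allFin k) (choices k n)

  -- The value 0 beyond the end of the list is junk.
  at : ∀ {k} → List (Fin k) → ℕ → ℕ
  at []      i       = 0
  at (x ∷ f) zero    = toℕ x
  at (x ∷ f) (suc i) = at f i

  at<k : ∀ {k} .{{_ : NonZero k}} (f : List (Fin k)) i → at f i < k
  at<k {suc k} []      i       = z<s
  at<k         (x ∷ f) zero    = toℕ<n x
  at<k         (x ∷ f) (suc i) = at<k f i

  ∑-choices : ∀ k n {F : List (Fin k) → ℕ} →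
              ∑ (choices k (suc n)) F ≡ ∑ (allFin k) (λ x → ∑ (choices k n) (λ f → F (x ∷ f)))
  ∑-choices k n = ∑-product _∷_ (allFin k) (choices k n)

  ∑-choices-const : ∀ k n c → ∑ (choices k n) (λ _ → c) ≡ k ^ n * c
  ∑-choices-const k zero    c = refl
  ∑-choices-const k (suc n) c = begin-equality
    ∑ (choices k (suc n)) (λ _ → c)                    ≡⟨ ∑-choices k n ⟩
    ∑ (allFin k) (λ _ → ∑ (choices k n) (λ _ → c))     ≡⟨ ∑-cong (allFin k) (λ _ → ∑-choices-const k n c) ⟩
    ∑ (allFin k) (λ _ → k ^ n * c)                     ≡⟨ ∑-allFin-const k (k ^ n * c) ⟩
    k * (k ^ n * c)                                    ≡⟨ *-assoc k (k ^ n) c ⟨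
    k ^ suc n * c                                      ∎
    where open ≤-Reasoning

  ∑-point : ∀ k a → ∑ (allFin k) (λ x → [ toℕ x ≟ a ]) ≤ 1
  ∑-point k a = begin
    ∑ (allFin k) (λ x → [ toℕ x ≟ a ])                   ≡⟨ ∑-allFin-toℕ k ⟩
    ∑ (upTo k) (λ x → [ x ≟ a ])                         ≤⟨ ∑-mono (upTo k) (λ x → []-mono (x ≟ a) ((a ≤? x) ×-dec (x <? a + 1)) λ { refl → ≤-refl , m<m+n x z<s }) ⟩
    ∑ (upTo k) (λ x → [ (a ≤? x) ×-dec (x <? a + 1) ])   ≤⟨ ∑-window k a 1 ⟩
    1                                                    ∎
    where open ≤-Reasoning

  -- Probability `1/k` with the denominator cleared; it is only an upper bound, because `a` may be
  -- outside the range of `Fin k`.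
  ∑-choices-at : ∀ k n {i} a → i < n → k * ∑ (choices k n) (λ f → [ at f i ≟ a ]) ≤ k ^ n
  ∑-choices-at k (suc n) {zero} a _ = *-monoʳ-≤ k (begin
    ∑ (choices k (suc n)) (λ f → [ at f 0 ≟ a ])                ≡⟨ ∑-choices k n ⟩
    ∑ (allFin k) (λ x → ∑ (choices k n) (λ _ → [ toℕ x ≟ a ]))  ≡⟨ ∑-cong (allFin k) (λ x → ∑-choices-const k n [ toℕ x ≟ a ]) ⟩
    ∑ (allFin k) (λ x → k ^ n * [ toℕ x ≟ a ])                  ≡⟨ ∑-*ˡ (allFin k) (k ^ n) ⟩
    k ^ n * ∑ (allFin k) (λ x → [ toℕ x ≟ a ])                  ≤⟨ *-monoʳ-≤ (k ^ n) (∑-point k a) ⟩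
    k ^ n * 1                                                   ≡⟨ *-identityʳ (k ^ n) ⟩
    k ^ n                                                       ∎)
    where open ≤-Reasoning
  ∑-choices-at k (suc n) {suc i} a (s≤s i<n) = *-monoʳ-≤ k (begin
    ∑ (choices k (suc n)) (λ f → [ at f (suc i) ≟ a ])          ≡⟨ ∑-choices k n ⟩
    ∑ (allFin k) (λ _ → ∑ (choices k n) (λ f → [ at f i ≟ a ])) ≡⟨ ∑-allFin-const k _ ⟩
    k * ∑ (choices k n) (λ f → [ at f i ≟ a ])                  ≤⟨ ∑-choices-at k n a i<n ⟩
    k ^ n                                                       ∎)
    where open ≤-Reasoning

  ∑-choices-at₂₀ : ∀ k n {j} a b → j < n →
                   k * k * ∑ (choices k (suc n)) (λ f → [ at f 0 ≟ a ] * [ at f (suc j) ≟ b ]) ≤ k ^ suc n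
  ∑-choices-at₂₀ k n {j} a b j<n = begin
    k * k * ∑ (choices k (suc n)) (λ f → [ at f 0 ≟ a ] * [ at f (suc j) ≟ b ])
      ≡⟨ cong (k * k *_) (trans (∑-choices k n) (∑-cong (allFin k) λ x → ∑-*ˡ (choices k n) [ toℕ x ≟ a ])) ⟩
    k * k * ∑ (allFin k) (λ x → [ toℕ x ≟ a ] * S)
      ≡⟨ cong (k * k *_) (∑-*ʳ (allFin k) S) ⟩
    k * k * (∑ (allFin k) (λ x → [ toℕ x ≟ a ]) * S)
      ≤⟨ *-monoʳ-≤ (k * k) (*-monoˡ-≤ S (∑-point k a)) ⟩
    k * k * (1 * S)
      ≡⟨ trans (cong (k * k *_) (*-identityˡ S)) (*-assoc k k S) ⟩
    k * (k * S)
      ≤⟨ *-monoʳ-≤ k (∑-choices-at k n b j<n) ⟩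
    k ^ suc n ∎
    where
    open ≤-Reasoning
    S = ∑ (choices k n) (λ f → [ at f j ≟ b ])

  -- Two distinct coordinates are independent. Leading coordinates are stripped until one of the two
  -- indices is 0, and that coordinate then factors out of the sum.
  ∑-choices-at₂ : ∀ k n {i j} a b → i < n → j < n → i ≢ j →
                  k * k * ∑ (choices k n) (λ f → [ at f i ≟ a ] * [ at f j ≟ b ]) ≤ k ^ n
  ∑-choices-at₂ k (suc n) {zero}  {zero}  a b _ _ i≢j = contradiction refl i≢j
  ∑-choices-at₂ k (suc n) {zero}  {suc j} a b _ (s≤s j<n) _ = ∑-choices-at₂₀ k n a b j<n
  ∑-choices-at₂ k (suc n) {suc i} {zero}  a b (s≤s i<n) _ _ = begin
    k * k * ∑ (choices k (suc n)) (λ f → [ at f (suc i) ≟ a ] * [ at f 0 ≟ b ])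
      ≡⟨ cong (k * k *_) (∑-cong (choices k (suc n)) λ f → *-comm [ at f (suc i) ≟ a ] [ at f 0 ≟ b ]) ⟩
    k * k * ∑ (choices k (suc n)) (λ f → [ at f 0 ≟ b ] * [ at f (suc i) ≟ a ])
      ≤⟨ ∑-choices-at₂₀ k n b a i<n ⟩
    k ^ suc n ∎
    where open ≤-Reasoning
  ∑-choices-at₂ k (suc n) {suc i} {suc j} a b (s≤s i<n) (s≤s j<n) i≢j = begin
    k * k * ∑ (choices k (suc n)) (λ f → [ at f (suc i) ≟ a ] * [ at f (suc j) ≟ b ])
      ≡⟨ cong (k * k *_) (trans (∑-choices k n) (∑-allFin-const k S)) ⟩
    k * k * (k * S)
      ≡⟨ lemma k S ⟩
    k * (k * k * S)
      ≤⟨ *-monoʳ-≤ k (∑-choices-at₂ k n a b i<n j<n (i≢j ∘ cong suc)) ⟩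
    k ^ suc n ∎
    where
    open ≤-Reasoning
    S = ∑ (choices k n) (λ f → [ at f i ≟ a ] * [ at f j ≟ b ])
    lemma : ∀ k S → k * k * (k * S) ≡ k * (k * k * S)
    lemma = solve-∀

  ∑-upTo-mono-< : ∀ n {F G : ℕ → ℕ} → (∀ x → x < n → F x ≤ G x) → ∑ (upTo n) F ≤ ∑ (upTo n) G
  ∑-upTo-mono-< zero            h = z≤n
  ∑-upTo-mono-< (suc n) {F} {G} h = begin
    ∑ (upTo (suc n)) F             ≡⟨ ∑-upTo-suc n F ⟩
    F 0 + ∑ (upTo n) (F ∘ suc)     ≤⟨ +-mono-≤ (h 0 z<s) (∑-upTo-mono-< n (λ x x<n → h (suc x) (s≤s x<n))) ⟩
    G 0 + ∑ (upTo n) (G ∘ suc)     ≡⟨ ∑-upTo-suc n G ⟨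
    ∑ (upTo (suc n)) G             ∎
    where open ≤-Reasoning

  -- Geometry of blocks, slots and gaps.

  [i*b+y]/b≡i : ∀ i {y b} .{{_ : NonZero b}} → y < b → (i * b + y) / b ≡ i
  [i*b+y]/b≡i i {y} {b} y<b =
    trans (+-distrib-/-∣ˡ y (n∣m*n i)) (trans (cong₂ _+_ (m*n/n≡m i b) (m<n⇒m/n≡0 y<b)) (+-identityʳ i))

  [i*b+y]%b≡y : ∀ i {y b} .{{_ : NonZero b}} → y < b → (i * b + y) % b ≡ y
  [i*b+y]%b≡y i {y} {b} y<b =
    trans (cong (_% b) (+-comm (i * b) y)) (trans ([m+kn]%n≡m%n y i b) (m<n⇒m%n≡m y<b))

  -- Blocks of k slots of length t, followed by a gap of length g.  In each of the
  -- first m blocks one slot survives, chosen by f.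
  module Layout (k t g m : ℕ) .{{_ : NonZero k}} .{{_ : NonZero t}} where

    b : ℕ
    b = g + k * t

    instance
      b≢0 : NonZero b
      b≢0 = ℕ.>-nonZero (≤-trans (ℕ.>-nonZero⁻¹ (k * t) {{m*n≢0 k t}}) (m≤n+m (k * t) g))

    block slot : ℕ → ℕ
    block u = u / b
    slot  u = u % b / t

    -- The bound on `slot u` excludes the gap, whose positions have quotients `k` and above; the
    -- bound on `block u` excludes what lies beyond the first `m` blocks.
    Survives : List (Fin k) → ℕ → Set
    Survives f u = block u < m × slot u < k × at f (block u) ≡ slot u

    survives? : ∀ f u → Dec (Survives f u)
    survives? f u = (block u <? m) ×-dec ((slot u <? k) ×-dec (at f (block u) ≟ slot u))

    coordinates : ∀ u → u ≡ block u * b + slot u * t + u % b % t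
    coordinates u = begin-equality
      u                                            ≡⟨ m≡m%n+[m/n]*n u b ⟩
      u % b + block u * b                          ≡⟨ cong (_+ block u * b) (m≡m%n+[m/n]*n (u % b) t) ⟩
      u % b % t + slot u * t + block u * b         ≡⟨ lemma (u % b % t) (slot u * t) (block u * b) ⟩
      block u * b + slot u * t + u % b % t         ∎
      where
      open ≤-Reasoning
      lemma : ∀ x y z → x + y + z ≡ z + y + x
      lemma = solve-∀

    survivor-window : ∀ f i u → Survives f u × block u ≡ i →
                      i * b + at f i * t ≤ u × u < i * b + at f i * t + t
    survivor-window f i u ((_ , _ , at≡slot) , refl) rewrite at≡slot =
      subst (block u * b + slot u * t ≤_) (sym (coordinates u)) (m≤m+n _ _) ,
      subst (_< block u * b + slot u * t + t) (sym (coordinates u)) (+-monoʳ-< _ (m%n<n (u % b) t))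

    survivors-per-block : ∀ n f i → ∑ (upTo n) (λ u → [ survives? f u ×-dec (block u ≟ i) ]) ≤ t
    survivors-per-block n f i = ≤-trans
      (∑-mono (upTo n) λ u → []-mono (survives? f u ×-dec (block u ≟ i))
                                     ((i * b + at f i * t ≤? u) ×-dec (u <? i * b + at f i * t + t))
                                     (survivor-window f i u))
      (∑-window n (i * b + at f i * t) t)

    -- A surviving slot ends before the gap of its own block begins, so the whole gap lies between
    -- `u` and any later block.
    crossing-gap : ∀ f {u v} → Survives f u → block u < block v → u + g < v
    crossing-gap f {u} {v} (_ , slot<k , _) bu<bv = begin-strict
      u + g                                        ≡⟨ cong (_+ g) (coordinates u) ⟩
      block u * b + slot u * t + u % b % t + g     <⟨ +-monoˡ-< g (+-monoʳ-< (block u * b + slot u * t) (m%n<n (u % b) t)) ⟩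
      block u * b + slot u * t + t + g             ≡⟨ lemma (block u * b) (slot u) t g ⟩
      block u * b + (g + suc (slot u) * t)         ≤⟨ +-monoʳ-≤ (block u * b) (+-monoʳ-≤ g (*-monoˡ-≤ t slot<k)) ⟩
      block u * b + b                              ≡⟨ +-comm (block u * b) b ⟩
      suc (block u) * b                            ≤⟨ *-monoˡ-≤ b bu<bv ⟩
      block v * b                                  ≤⟨ m/n*n≤m v b ⟩
      v                                            ∎
      where
      open ≤-Reasoning
      lemma : ∀ x y t g → x + y * t + t + g ≡ x + (g + (t + y * t))
      lemma = solve-∀

    far : ∀ {u v} → u + g < v → g < ∣ u - v ∣
    far {u} {v} u+g<v = subst (g <_) (sym (m≤n⇒∣m-n∣≡n∸m (≤-trans (m≤m+n u g) (<⇒≤ u+g<v))))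
                              (m+n≤o⇒m≤o∸n (suc g) (subst (_< v) (+-comm u g) u+g<v))

    crossing-long : ∀ f {u v} → Survives f u → Survives f v → block u ≢ block v → g < ∣ u - v ∣
    crossing-long f {u} {v} su sv bu≢bv with <-cmp (block u) (block v)
    ... | tri< bu<bv _ _ = far (crossing-gap f su bu<bv)
    ... | tri≈ _ bu≡bv _ = contradiction bu≡bv bu≢bv
    ... | tri> _ _ bv<bu = subst (g <_) (∣-∣-comm v u) (far (crossing-gap f sv bv<bu))

    slot-survives : ∀ f i x → i < m → x < t → Survives f (i * b + (at f i * t + x))
    slot-survives f i x i<m x<t = subst (_< m) (sym block≡i) i<m , subst (_< k) (sym slot≡) (at<k f i) ,
      trans (cong (at f) block≡i) (sym slot≡)
      where
      y<b : at f i * t + x < b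
      y<b = begin-strict
        at f i * t + x     <⟨ +-monoʳ-< (at f i * t) x<t ⟩
        at f i * t + t     ≡⟨ +-comm (at f i * t) t ⟩
        suc (at f i) * t   ≤⟨ *-monoˡ-≤ t (at<k f i) ⟩
        k * t              ≤⟨ m≤n+m (k * t) g ⟩
        b                  ∎
        where open ≤-Reasoning
      block≡i : block (i * b + (at f i * t + x)) ≡ i
      block≡i = [i*b+y]/b≡i i y<b
      slot≡ : slot (i * b + (at f i * t + x)) ≡ at f i
      slot≡ = trans (cong (_/ t) ([i*b+y]%b≡y i y<b)) ([i*b+y]/b≡i (at f i) x<t)

    survivors-in-block : ∀ f i → i < m → t ≤ ∑ (upTo b) (λ x → [ survives? f (i * b + x) ])
    survivors-in-block f i i<m with m≤n⇒∃[o]m+o≡n end≤b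
      where
      end≤b : at f i * t + t ≤ b
      end≤b = begin
        at f i * t + t     ≡⟨ +-comm (at f i * t) t ⟩
        suc (at f i) * t   ≤⟨ *-monoˡ-≤ t (at<k f i) ⟩
        k * t              ≤⟨ m≤n+m (k * t) g ⟩
        b                  ∎
        where open ≤-Reasoning
    ... | o , c+t+o≡b = begin
      t                                               ≡⟨ *-identityʳ t ⟨
      t * 1                                           ≡⟨ ∑-upTo-const t 1 ⟨
      ∑ (upTo t) (λ _ → 1)                            ≤⟨ ∑-upTo-mono-< t (λ x x<t → []≥1 (survives? f (i * b + (c + x))) (slot-survives f i x i<m x<t)) ⟩
      ∑ (upTo t) (λ x → F (c + x))                    ≤⟨ m≤n+m _ (∑ (upTo c) F) ⟩
      ∑ (upTo c) F + ∑ (upTo t) (λ x → F (c + x))     ≡⟨ ∑-upTo-+ c t ⟨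
      ∑ (upTo (c + t)) F                              ≤⟨ ∑-upTo-mono (subst (c + t ≤_) c+t+o≡b (m≤m+n (c + t) o)) F ⟩
      ∑ (upTo b) F                                    ∎
      where
      open ≤-Reasoning
      c = at f i * t
      F = λ x → [ survives? f (i * b + x) ]

    survivors-total : ∀ {n} f → m * b ≤ n → m * t ≤ ∑ (upTo n) (λ u → [ survives? f u ])
    survivors-total {n} f m*b≤n = begin
      m * t                                                             ≡⟨ ∑-upTo-const m t ⟨
      ∑ (upTo m) (λ _ → t)                                              ≤⟨ ∑-upTo-mono-< m (survivors-in-block f) ⟩
      ∑ (upTo m) (λ i → ∑ (upTo b) (λ x → [ survives? f (i * b + x) ])) ≡⟨ ∑-upTo-* m b ⟨
      ∑ (upTo (m * b)) (λ u → [ survives? f u ])                        ≤⟨ ∑-upTo-mono m*b≤n (λ u → [ survives? f u ]) ⟩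
      ∑ (upTo n) (λ u → [ survives? f u ])                              ∎
      where open ≤-Reasoning

  -- The attack set of one outcome.

  subset : ∀ {n} {P : Fin n → Set} → (∀ u → Dec (P u)) → Subset n
  subset P? = tabulate (does ∘ P?)

  module _ {n} {P : Fin n → Set} (P? : ∀ u → Dec (P u)) where

    ∈-subset⁺ : ∀ {u} → P u → u ∈ subset P?
    ∈-subset⁺ {u} pu = lookup⇒[]= u _ (trans (lookup∘tabulate (does ∘ P?) u) (does-true (P? u)))
      where
      does-true : (d : Dec (P u)) → does d ≡ true
      does-true (yes _)  = refl
      does-true (no ¬pu) = contradiction pu ¬pu

    ∈-subset⁻ : ∀ {u} → u ∈ subset P? → P u
    ∈-subset⁻ {u} u∈ = true-does (P? u) (trans (sym (lookup∘tabulate (does ∘ P?) u)) ([]=⇒lookup u∈))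
      where
      true-does : (d : Dec (P u)) → does d ≡ true → P u
      true-does (yes pu) _ = pu

  module Attack (n k t g m : ℕ) .{{_ : NonZero k}} .{{_ : NonZero t}} (f : List (Fin k)) where
    open Layout k t g m

    killed? : ∀ (u : Fin n) → Dec (¬ Survives f (toℕ u))
    killed? u = ¬? (survives? f (toℕ u))

    attack : Subset n
    attack = subset killed?

    survives : ∀ {u} → u ∉ attack → Survives f (toℕ u)
    survives {u} u∉ with survives? f (toℕ u)
    ... | yes s = s
    ... | no ¬s = contradiction (∈-subset⁺ killed? ¬s) u∉

    ∣attack∣ : m * b ≤ n → ∣ attack ∣ + m * t ≤ n
    ∣attack∣ m*b≤n = begin
      ∣ attack ∣ + m * t
        ≤⟨ +-mono-≤ (≤-reflexive (∣∣≡∑ attack)) (survivors-total f m*b≤n) ⟩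
      ∑ (allFin n) (λ u → [ u ∈? attack ]) + ∑ (upTo n) (λ u → [ survives? f u ])
        ≡⟨ cong (∑ (allFin n) (λ u → [ u ∈? attack ]) +_) (∑-allFin-toℕ n) ⟨
      ∑ (allFin n) (λ u → [ u ∈? attack ]) + ∑ (allFin n) (λ u → [ survives? f (toℕ u) ])
        ≡⟨ ∑-+ (allFin n) ⟨
      ∑ (allFin n) (λ u → [ u ∈? attack ] + [ survives? f (toℕ u) ])
        ≤⟨ ∑-mono (allFin n) disjoint ⟩
      ∑ (allFin n) (λ _ → 1)
        ≡⟨ trans (∑-allFin-const n 1) (*-identityʳ n) ⟩
      n ∎
      where
      open ≤-Reasoning
      disjoint : ∀ u → [ u ∈? attack ] + [ survives? f (toℕ u) ] ≤ 1
      disjoint u with survives? f (toℕ u)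
      ... | yes s = ≤-reflexive (cong (_+ 1) ([]-false (u ∈? attack) λ u∈ → ∈-subset⁻ killed? u∈ s))
      ... | no  _ = subst (_≤ 1) (sym (+-identityʳ _)) ([]≤1 (u ∈? attack))

  -- Crossing edges at a single scale.

  module _ {n} (G : Graph n) where
    open Graph G

    edge? : ∀ u v → Dec (Edge u v)
    edge? u v = T? (adj u v)

    -- Runs over ordered pairs, so every edge counts twice, exactly as in `edgeLengths`; the factor
    -- 2 is settled once, in `edgeLengths≤`.
    longEdges : ℕ → ℕ
    longEdges g = ∑ (allFin n) λ u → ∑ (allFin n) λ v → [ edge? u v ×-dec (g <? ∣ toℕ u - toℕ v ∣) ]

    module Crossings (k t g m : ℕ) .{{_ : NonZero k}} .{{_ : NonZero t}} (f : List (Fin k)) where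
      open Layout k t g m
      open Attack n k t g m f

      Crossing : Fin n → Fin n → Set
      Crossing u v = Edge u v × Survives f (toℕ u) × Survives f (toℕ v) × block (toℕ u) ≢ block (toℕ v)

      crossing? : ∀ u v → Dec (Crossing u v)
      crossing? u v = edge? u v ×-dec (survives? f (toℕ u) ×-dec (survives? f (toℕ v) ×-dec ¬? (block (toℕ u) ≟ block (toℕ v))))

      crossings : ℕ
      crossings = ∑ (allFin n) λ u → ∑ (allFin n) λ v → [ crossing? u v ]

      -- Follow the walk to its first step between different blocks. All earlier vertices share the
      -- block of `u`, and the walk avoids the attack, so both ends of that step survive.
      walk-leaves-block : ∀ {u v} → ConnectedOutside attack u v → block (toℕ u) ≢ block (toℕ v) →
                          ∃[ x ] ∃[ y ] Crossing x y × block (toℕ x) ≡ block (toℕ u)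
      walk-leaves-block ε ≢ = contradiction refl ≢
      walk-leaves-block {u} (_◅_ {j = w} (e , u∉ , w∉) walk) ≢ with block (toℕ u) ≟ block (toℕ w)
      ... | no  u≢w = u , w , (e , survives u∉ , survives w∉ , u≢w) , refl
      ... | yes u≡w with walk-leaves-block walk (≢ ∘ trans u≡w)
      ...   | x , y , cr , x≡w = x , y , cr , trans x≡w (sym u≡w)

      survivors-in : ℕ → ℕ
      survivors-in i = ∑ (allFin n) λ u → [ survives? f (toℕ u) ×-dec (block (toℕ u) ≟ i) ]

      survivors-in≤t : ∀ i → survivors-in i ≤ t
      survivors-in≤t i = subst (_≤ t) (sym (∑-allFin-toℕ n)) (survivors-per-block n f i)

      module _ (B⁺ : Subset n) (attack⊆B⁺ : attack ⊆ B⁺)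
               (connected : ∀ u v → u ∉ B⁺ → v ∉ B⁺ → ConnectedOutside attack u v) where

        same-block : Fin n → Fin n → ℕ
        same-block u x = [ survives? f (toℕ u) ×-dec (block (toℕ u) ≟ block (toℕ x)) ]

        via-crossing : Fin n → ℕ
        via-crossing u = ∑ (allFin n) λ x → ∑ (allFin n) λ y → [ crossing? x y ] * same-block u x

        -- Every vertex outside `B⁺` is joined to the fixed `u₀`. If it lies in another block, its
        -- walk to `u₀` leaves its block by a crossing, and the vertex is charged to that crossing.
        outside-bound : ∀ {u₀} → u₀ ∉ B⁺ → ∀ u → 1 ≤ [ u ∈? B⁺ ] + same-block u u₀ + via-crossing u
        outside-bound {u₀} u₀∉ u with u ∈? B⁺
        ... | yes _  = s≤s z≤n
        ... | no  u∉ = by-block (block (toℕ u) ≟ block (toℕ u₀))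
          where
          su : Survives f (toℕ u)
          su = survives (u∉ ∘ attack⊆B⁺)

          same-block≡1 : ∀ {x} → block (toℕ u) ≡ block (toℕ x) → same-block u x ≡ 1
          same-block≡1 {x} u≡x = []-true (survives? f (toℕ u) ×-dec (block (toℕ u) ≟ block (toℕ x))) (su , u≡x)

          by-block : Dec (block (toℕ u) ≡ block (toℕ u₀)) → 1 ≤ same-block u u₀ + via-crossing u
          by-block (yes u≡u₀) = ≤-trans (≤-reflexive (sym (same-block≡1 u≡u₀))) (m≤m+n (same-block u u₀) (via-crossing u))
          by-block (no  u≢u₀) with walk-leaves-block (connected u u₀ u∉ u₀∉) u≢u₀
          ... | x , y , cr , x≡u = begin
            1                                                         ≡⟨ cong₂ _*_ ([]-true (crossing? x y) cr) (same-block≡1 (sym x≡u)) ⟨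
            [ crossing? x y ] * same-block u x                        ≤⟨ ≤∑-allFin (λ y → [ crossing? x y ] * same-block u x) y ⟩
            ∑ (allFin n) (λ y → [ crossing? x y ] * same-block u x)   ≤⟨ ≤∑-allFin (λ x → ∑ (allFin n) λ y → [ crossing? x y ] * same-block u x) x ⟩
            via-crossing u                                            ≤⟨ m≤n+m (via-crossing u) (same-block u u₀) ⟩
            same-block u u₀ + via-crossing u                          ∎
            where open ≤-Reasoning

        -- Double counting: a crossing is charged only by the survivors of the block in which it
        -- starts, and these are at most `t`.
        via-crossings : ∑ (allFin n) via-crossing ≤ t * crossings
        via-crossings = begin
          ∑ (allFin n) via-crossing
            ≡⟨ trans (∑-swap (allFin n) (allFin n)) (∑-cong (allFin n) λ x → ∑-swap (allFin n) (allFin n)) ⟩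
          ∑ (allFin n) (λ x → ∑ (allFin n) λ y → ∑ (allFin n) λ u → [ crossing? x y ] * same-block u x)
            ≡⟨ ∑-cong (allFin n) (λ x → ∑-cong (allFin n) λ y → ∑-*ˡ (allFin n) [ crossing? x y ]) ⟩
          ∑ (allFin n) (λ x → ∑ (allFin n) λ y → [ crossing? x y ] * survivors-in (block (toℕ x)))
            ≤⟨ ∑-mono (allFin n) (λ x → ∑-mono (allFin n) λ y → *-monoʳ-≤ [ crossing? x y ] (survivors-in≤t (block (toℕ x)))) ⟩
          ∑ (allFin n) (λ x → ∑ (allFin n) λ y → [ crossing? x y ] * t)
            ≡⟨ ∑-cong (allFin n) (λ x → ∑-*ʳ (allFin n) t) ⟩
          ∑ (allFin n) (λ x → ∑ (allFin n) (λ y → [ crossing? x y ]) * t)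
            ≡⟨ trans (∑-*ʳ (allFin n) t) (*-comm crossings t) ⟩
          t * crossings ∎
          where open ≤-Reasoning

        -- Sum of `outside-bound` over all vertices. The single `t` pays for the block of `u₀`, from
        -- which no crossing need leave.
        survivors-scattered : n ≤ ∣ B⁺ ∣ + t + t * crossings
        survivors-scattered with any? (λ u → ¬? (u ∈? B⁺))
        -- No `u₀` exists here, but then `B⁺` is everything and accounts for all `n` vertices alone.
        ... | no none = ≤-trans full (≤-trans (m≤m+n ∣ B⁺ ∣ t) (m≤m+n _ _))
          where
          open ≤-Reasoning
          all∈ : ∀ u → 1 ≤ [ u ∈? B⁺ ]
          all∈ u with u ∈? B⁺
          ... | yes _ = ≤-refl
          ... | no u∉ = contradiction (u , u∉) none
          full : n ≤ ∣ B⁺ ∣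
          full = begin
            n                                  ≡⟨ trans (∑-allFin-const n 1) (*-identityʳ n) ⟨
            ∑ (allFin n) (λ _ → 1)             ≤⟨ ∑-mono (allFin n) all∈ ⟩
            ∑ (allFin n) (λ u → [ u ∈? B⁺ ])   ≡⟨ ∣∣≡∑ B⁺ ⟨
            ∣ B⁺ ∣                             ∎
        ... | yes (u₀ , u₀∉) = begin
          n
            ≡⟨ trans (∑-allFin-const n 1) (*-identityʳ n) ⟨
          ∑ (allFin n) (λ _ → 1)
            ≤⟨ ∑-mono (allFin n) (outside-bound u₀∉) ⟩
          ∑ (allFin n) (λ u → [ u ∈? B⁺ ] + same-block u u₀ + via-crossing u)
            ≡⟨ trans (∑-+ (allFin n)) (cong (_+ ∑ (allFin n) via-crossing) (∑-+ (allFin n))) ⟩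
          ∑ (allFin n) (λ u → [ u ∈? B⁺ ]) + survivors-in (block (toℕ u₀)) + ∑ (allFin n) via-crossing
            ≤⟨ +-mono-≤ (+-mono-≤ (≤-reflexive (sym (∣∣≡∑ B⁺))) (survivors-in≤t (block (toℕ u₀)))) via-crossings ⟩
          ∣ B⁺ ∣ + t + t * crossings ∎
          where open ≤-Reasoning

    module _ (k t g m : ℕ) .{{_ : NonZero k}} .{{_ : NonZero t}} (m≤n : m ≤ n) where
      open Layout k t g m
      open Crossings k t g m using (Crossing; crossing?; crossings)

      -- A short edge is never a crossing. For a long one, crossing prescribes the chosen slots of
      -- two different blocks, an event of probability at most `1/k²`.
      crossing-probability : ∀ u v →
        k * k * ∑ (choices k n) (λ f → [ crossing? f u v ]) ≤ k ^ n * [ edge? u v ×-dec (g <? ∣ toℕ u - toℕ v ∣) ]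
      crossing-probability u v with edge? u v ×-dec (g <? ∣ toℕ u - toℕ v ∣)
      ... | no ¬long = ≤-reflexive (begin-equality
        k * k * ∑ (choices k n) (λ f → [ crossing? f u v ]) ≡⟨ cong (k * k *_) (∑-cong (choices k n) λ f → []-false (crossing? f u v) λ (e , su , sv , ≢) → ¬long (e , crossing-long f su sv ≢)) ⟩
        k * k * ∑ (choices k n) (λ _ → 0)                   ≡⟨ cong (k * k *_) (trans (∑-choices-const k n 0) (*-zeroʳ (k ^ n))) ⟩
        k * k * 0                                           ≡⟨ *-zeroʳ (k * k) ⟩
        0                                                   ≡⟨ *-zeroʳ (k ^ n) ⟨
        k ^ n * 0                                           ∎)
        where open ≤-Reasoning
      -- Blocks from `m` on have no survivors. For the others `m ≤ n` keeps both indices within the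
      -- lists of `choices k n`, where independence applies.
      ... | yes _ with (block (toℕ u) <? m) ×-dec ((block (toℕ v) <? m) ×-dec ¬? (block (toℕ u) ≟ block (toℕ v)))
      ...   | no ¬h = begin
        k * k * ∑ (choices k n) (λ f → [ crossing? f u v ]) ≡⟨ cong (k * k *_) (∑-cong (choices k n) λ f → []-false (crossing? f u v) λ (e , su , sv , ≢) → ¬h (proj₁ su , proj₁ sv , ≢)) ⟩
        k * k * ∑ (choices k n) (λ _ → 0)                   ≡⟨ cong (k * k *_) (trans (∑-choices-const k n 0) (*-zeroʳ (k ^ n))) ⟩
        k * k * 0                                           ≡⟨ *-zeroʳ (k * k) ⟩
        0                                                   ≤⟨ z≤n ⟩
        k ^ n * 1                                           ∎
        where open ≤-Reasoning
      ...   | yes (bu<m , bv<m , bu≢bv) = begin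
        k * k * ∑ (choices k n) (λ f → [ crossing? f u v ])
          ≤⟨ *-monoʳ-≤ (k * k) (∑-mono (choices k n) λ f → []≤ (crossing? f u v) λ (_ , su , sv , _) →
               ≤-reflexive (sym (cong₂ _*_ ([]-true (at f (block (toℕ u)) ≟ slot (toℕ u)) (proj₂ (proj₂ su)))
                                           ([]-true (at f (block (toℕ v)) ≟ slot (toℕ v)) (proj₂ (proj₂ sv)))))) ⟩
        k * k * ∑ (choices k n) (λ f → [ at f (block (toℕ u)) ≟ slot (toℕ u) ] * [ at f (block (toℕ v)) ≟ slot (toℕ v) ])
          ≤⟨ ∑-choices-at₂ k n (slot (toℕ u)) (slot (toℕ v)) (≤-trans bu<m m≤n) (≤-trans bv<m m≤n) bu≢bv ⟩
        k ^ n
          ≡⟨ *-identityʳ (k ^ n) ⟨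
        k ^ n * 1 ∎
        where open ≤-Reasoning

      expected-crossings : k * k * ∑ (choices k n) crossings ≤ k ^ n * longEdges g
      expected-crossings = begin
        k * k * ∑ (choices k n) crossings
          ≡⟨ cong (k * k *_) (trans (∑-swap (choices k n) (allFin n)) (∑-cong (allFin n) λ u → ∑-swap (choices k n) (allFin n))) ⟩
        k * k * ∑ (allFin n) (λ u → ∑ (allFin n) λ v → ∑ (choices k n) λ f → [ crossing? f u v ])
          ≡⟨ trans (∑-cong (allFin n) λ u → ∑-*ˡ (allFin n) (k * k)) (∑-*ˡ (allFin n) (k * k)) ⟨
        ∑ (allFin n) (λ u → ∑ (allFin n) λ v → k * k * ∑ (choices k n) λ f → [ crossing? f u v ])
          ≤⟨ ∑-mono (allFin n) (λ u → ∑-mono (allFin n) (crossing-probability u)) ⟩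
        ∑ (allFin n) (λ u → ∑ (allFin n) λ v → k ^ n * [ edge? u v ×-dec (g <? ∣ toℕ u - toℕ v ∣) ])
          ≡⟨ trans (∑-cong (allFin n) λ u → ∑-*ˡ (allFin n) (k ^ n)) (∑-*ˡ (allFin n) (k ^ n)) ⟩
        k ^ n * longEdges g ∎
        where open ≤-Reasoning

  -- Combining the scales.

  ∑-2^≤ : ∀ J → ∑ (upTo J) (2 ^_) ≤ 2 ^ J
  ∑-2^≤ zero    = z≤n
  ∑-2^≤ (suc J) = begin
    ∑ (upTo (suc J)) (2 ^_)     ≡⟨ ∑-upTo-last J ⟩
    ∑ (upTo J) (2 ^_) + 2 ^ J   ≤⟨ +-monoˡ-≤ (2 ^ J) (∑-2^≤ J) ⟩
    2 ^ J + 2 ^ J               ≡⟨ cong (2 ^ J +_) (+-identityʳ (2 ^ J)) ⟨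
    2 ^ suc J                   ∎
    where open ≤-Reasoning

  -- The scales below d have geometrically growing sizes, so the last one dominates.
  ∑-geometric : ∀ k d J → k * ∑ (upTo J) (λ j → 2 ^ j * [ k * 2 ^ j <? d ]) ≤ 2 * d
  ∑-geometric k d zero    = subst (_≤ 2 * d) (sym (*-zeroʳ k)) z≤n
  ∑-geometric k d (suc J) with k * 2 ^ J <? d in eq
  ... | no ¬p = begin
    k * ∑ (upTo (suc J)) F      ≡⟨ cong (k *_) (∑-upTo-last J) ⟩
    k * (∑ (upTo J) F + F J)    ≡⟨ cong (λ x → k * (∑ (upTo J) F + 2 ^ J * x)) ([]-false (k * 2 ^ J <? d) ¬p) ⟩
    k * (∑ (upTo J) F + 2 ^ J * 0) ≡⟨ cong (k *_) (trans (cong (∑ (upTo J) F +_) (*-zeroʳ (2 ^ J))) (+-identityʳ _)) ⟩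
    k * ∑ (upTo J) F            ≤⟨ ∑-geometric k d J ⟩
    2 * d                       ∎
    where
    open ≤-Reasoning
    F = λ j → 2 ^ j * [ k * 2 ^ j <? d ]
  -- The top scale is below `d`, so all indicators may be replaced by 1: the full sum is at most
  -- twice its last power, and `k * 2 ^ J < d` bounds that power.
  ... | yes p = begin
    k * ∑ (upTo (suc J)) F      ≤⟨ *-monoʳ-≤ k (∑-mono (upTo (suc J)) λ j → ≤-trans (*-monoʳ-≤ (2 ^ j) ([]≤1 (k * 2 ^ j <? d))) (≤-reflexive (*-identityʳ (2 ^ j)))) ⟩
    k * ∑ (upTo (suc J)) (2 ^_) ≤⟨ *-monoʳ-≤ k (∑-2^≤ (suc J)) ⟩
    k * (2 * 2 ^ J)             ≡⟨ lemma k (2 ^ J) ⟩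
    2 * (k * 2 ^ J)             ≤⟨ *-monoʳ-≤ 2 (<⇒≤ p) ⟩
    2 * d                       ∎
    where
    open ≤-Reasoning
    F = λ j → 2 ^ j * [ k * 2 ^ j <? d ]
    lemma : ∀ k x → k * (2 * x) ≡ 2 * (k * x)
    lemma = solve-∀

  module _ {n} (G : Graph n) where
    open Graph G

    edgeLengths : ℕ
    edgeLengths = ∑ (allFin n) λ u → ∑ (allFin n) λ v → [ edge? G u v ] * ∣ toℕ u - toℕ v ∣

    -- Copies the form of the summand of `totalWeight`, so that lengths and weights can be compared
    -- term by term.
    forwardLength : Fin n → Fin n → ℕ
    forwardLength u v = if (toℕ u <ᵇ toℕ v) ∧ adj u v then ∣ toℕ u - toℕ v ∣ else 0

    forward : ∀ {u v} → toℕ u < toℕ v → [ edge? G u v ] * ∣ toℕ u - toℕ v ∣ ≤ forwardLength u v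
    forward {u} {v} u<v with toℕ u <ᵇ toℕ v | <⇒<ᵇ u<v | adj u v
    ... | true | _ | true  = ≤-reflexive (+-identityʳ _)
    ... | true | _ | false = z≤n

    edgeLength≤ : ∀ u v → [ edge? G u v ] * ∣ toℕ u - toℕ v ∣ ≤ forwardLength u v + forwardLength v u
    edgeLength≤ u v with <-cmp (toℕ u) (toℕ v)
    ... | tri< u<v _ _ = ≤-trans (forward u<v) (m≤m+n (forwardLength u v) (forwardLength v u))
    ... | tri≈ _ u≡v _ = ≤-trans (≤-reflexive (trans (cong ([ edge? G u v ] *_) (m≡n⇒∣m-n∣≡0 u≡v)) (*-zeroʳ [ edge? G u v ]))) z≤n
    ... | tri> _ _ v<u = begin
      [ edge? G u v ] * ∣ toℕ u - toℕ v ∣   ≤⟨ *-monoˡ-≤ ∣ toℕ u - toℕ v ∣ ([]-mono (edge? G u v) (edge? G v u) (subst T (adj-sym u v))) ⟩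
      [ edge? G v u ] * ∣ toℕ u - toℕ v ∣   ≡⟨ cong ([ edge? G v u ] *_) (∣-∣-comm (toℕ u) (toℕ v)) ⟩
      [ edge? G v u ] * ∣ toℕ v - toℕ u ∣   ≤⟨ forward v<u ⟩
      forwardLength v u                     ≤⟨ m≤n+m (forwardLength v u) (forwardLength u v) ⟩
      forwardLength u v + forwardLength v u ∎
      where open ≤-Reasoning

    edgeLengths≤ : edgeLengths ≤ 2 * ∑ (allFin n) (λ u → ∑ (allFin n) (forwardLength u))
    edgeLengths≤ = begin
      edgeLengths
        ≤⟨ ∑-mono (allFin n) (λ u → ∑-mono (allFin n) (edgeLength≤ u)) ⟩
      ∑ (allFin n) (λ u → ∑ (allFin n) λ v → forwardLength u v + forwardLength v u)
        ≡⟨ trans (∑-cong (allFin n) λ u → ∑-+ (allFin n)) (∑-+ (allFin n)) ⟩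
      S + ∑ (allFin n) (λ u → ∑ (allFin n) λ v → forwardLength v u)
        ≡⟨ cong (S +_) (∑-swap (allFin n) (allFin n)) ⟩
      S + S
        ≡⟨ cong (S +_) (+-identityʳ S) ⟨
      2 * S ∎
      where
      open ≤-Reasoning
      S = ∑ (allFin n) (λ u → ∑ (allFin n) (forwardLength u))

  record Scale (n k : ℕ) : Set where
    field
      t g m   : ℕ
      {{t≢0}} : NonZero t
      fits    : m * (g + k * t) ≤ n

    -- An upper bound for the size of every attack at this scale, by `∣attack∣`.
    dead : ℕ
    dead = n ∸ m * t

  module _ {n k J} .{{_ : NonZero k}} (scale : Fin J → Scale n k) where
    private
      open module S (j : Fin J) = Scale (scale j)
      js = allFin J
      P  = k ^ n
      fs = choices k n

      instance
        t≢0′ : ∀ {j} → NonZero (t j)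
        t≢0′ {j} = t≢0 j

    scaleAttack : Fin J → List (Fin k) → Subset n
    scaleAttack j f = Attack.attack n k (t j) (g j) (m j) f

    -- One entry per scale and outcome, with repetitions, so that a sum over this list is an
    -- unnormalised average.
    attacks : List (Subset n)
    attacks = cartesianProductWith scaleAttack js fs

    ∑-attacks : ∀ {F} → ∑ attacks F ≡ ∑ js (λ j → ∑ fs (λ f → F (scaleAttack j f)))
    ∑-attacks = ∑-product scaleAttack js fs

    attacks-size : ∑ attacks ∣_∣ ≤ P * ∑ js dead
    attacks-size = begin
      ∑ attacks ∣_∣                                   ≡⟨ ∑-attacks ⟩
      ∑ js (λ j → ∑ fs (λ f → ∣ scaleAttack j f ∣))   ≤⟨ ∑-mono js (λ j → ∑-mono fs λ f → m+n≤o⇒m≤o∸n _ (Attack.∣attack∣ n k (t j) (g j) (m j) f (fits j))) ⟩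
      ∑ js (λ j → ∑ fs (λ f → dead j))                ≡⟨ trans (∑-cong js λ j → ∑-choices-const k n (dead j)) (∑-*ˡ js P) ⟩
      P * ∑ js dead                                   ∎
      where open ≤-Reasoning

    module _ (G : Graph n) (B⁺ : Subset n → Subset n) (⊆B⁺ : ∀ B → B ⊆ B⁺ B)
             (connected : ∀ B u v → u ∉ B⁺ B → v ∉ B⁺ B → Graph.ConnectedOutside G B u v) where

      -- `survivors-scattered` summed over all outcomes; the factor `k * k` clears the denominator
      -- of `expected-crossings`.
      scale-bound : ∀ j → k * k * (P * n) ≤
        k * k * ∑ fs (λ f → ∣ B⁺ (scaleAttack j f) ∣) + k * k * P * t j + P * (t j * longEdges G (g j))
      scale-bound j = begin
        k * k * (P * n)
          ≡⟨ cong (k * k *_) (∑-choices-const k n n) ⟨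
        k * k * ∑ fs (λ _ → n)
          ≤⟨ *-monoʳ-≤ (k * k) (∑-mono fs λ f → Crossings.survivors-scattered G k (t j) (g j) (m j) f
               (B⁺ (scaleAttack j f)) (⊆B⁺ (scaleAttack j f)) (connected (scaleAttack j f))) ⟩
        k * k * ∑ fs (λ f → ∣ B⁺ (scaleAttack j f) ∣ + t j + t j * crossings f)
          ≡⟨ cong (k * k *_) (trans (∑-+ fs) (cong₂ _+_ (trans (∑-+ fs) (cong (X +_) (∑-choices-const k n (t j)))) (∑-*ˡ fs (t j)))) ⟩
        k * k * (X + P * t j + t j * ∑ fs crossings)
          ≡⟨ lemma (k * k) X P (t j) (∑ fs crossings) ⟩
        k * k * X + k * k * P * t j + t j * (k * k * ∑ fs crossings)
          ≤⟨ +-monoʳ-≤ (k * k * X + k * k * P * t j) (*-monoʳ-≤ (t j) (expected-crossings G k (t j) (g j) (m j) m≤n)) ⟩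
        k * k * X + k * k * P * t j + t j * (P * longEdges G (g j))
          ≡⟨ cong (k * k * X + k * k * P * t j +_) (lemma′ (t j) P (longEdges G (g j))) ⟩
        k * k * X + k * k * P * t j + P * (t j * longEdges G (g j)) ∎
        where
        open ≤-Reasoning
        X = ∑ fs (λ f → ∣ B⁺ (scaleAttack j f) ∣)
        crossings = Crossings.crossings G k (t j) (g j) (m j)
        m≤n : m j ≤ n
        m≤n = ≤-trans (m≤m*n (m j) (g j + k * t j) {{Layout.b≢0 k (t j) (g j) (m j)}}) (fits j)
        lemma : ∀ q x p y z → q * (x + p * y + y * z) ≡ q * x + q * p * y + y * (q * z)
        lemma = solve-∀
        lemma′ : ∀ x y z → x * (y * z) ≡ y * (x * z)
        lemma′ = solve-∀

      module _ (r : ℕ) (geometric : ∀ d → k * ∑ js (λ j → t j * [ g j <? d ]) ≤ 2 * r * d) where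

        -- Exchanging the sums lets each edge collect its charges from all scales at once;
        -- `geometric` bounds them by its length.
        longEdges-bound : k * ∑ js (λ j → t j * longEdges G (g j)) ≤ 2 * r * edgeLengths G
        longEdges-bound = begin
          k * ∑ js (λ j → t j * longEdges G (g j))
            ≡⟨ cong (k *_) (∑-cong js λ j → trans (∑-cong vs λ u → ∑-*ˡ vs (t j)) (∑-*ˡ vs (t j))) ⟨
          k * ∑ js (λ j → ∑ vs λ u → ∑ vs λ v → t j * [ edge? G u v ×-dec (g j <? ∣ toℕ u - toℕ v ∣) ])
            ≡⟨ cong (k *_) (trans (∑-swap js vs) (∑-cong vs λ u → ∑-swap js vs)) ⟩
          k * ∑ vs (λ u → ∑ vs λ v → ∑ js λ j → t j * [ edge? G u v ×-dec (g j <? ∣ toℕ u - toℕ v ∣) ])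
            ≡⟨ trans (∑-cong vs λ u → ∑-*ˡ vs k) (∑-*ˡ vs k) ⟨
          ∑ vs (λ u → ∑ vs λ v → k * ∑ js λ j → t j * [ edge? G u v ×-dec (g j <? ∣ toℕ u - toℕ v ∣) ])
            ≤⟨ ∑-mono vs (λ u → ∑-mono vs λ v → per-edge u v) ⟩
          ∑ vs (λ u → ∑ vs λ v → 2 * r * ([ edge? G u v ] * ∣ toℕ u - toℕ v ∣))
            ≡⟨ trans (∑-cong vs λ u → ∑-*ˡ vs (2 * r)) (∑-*ˡ vs (2 * r)) ⟩
          2 * r * edgeLengths G ∎
          where
          open ≤-Reasoning
          vs = allFin n
          per-edge : ∀ u v → k * ∑ js (λ j → t j * [ edge? G u v ×-dec (g j <? ∣ toℕ u - toℕ v ∣) ])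
                             ≤ 2 * r * ([ edge? G u v ] * ∣ toℕ u - toℕ v ∣)
          per-edge u v with edge? G u v
          ... | yes e = begin
            k * ∑ js (λ j → t j * [ yes e ×-dec (g j <? ∣ toℕ u - toℕ v ∣) ])
              ≤⟨ *-monoʳ-≤ k (∑-mono js λ j → *-monoʳ-≤ (t j) ([]-mono (yes e ×-dec (g j <? ∣ toℕ u - toℕ v ∣)) (g j <? ∣ toℕ u - toℕ v ∣) proj₂)) ⟩
            k * ∑ js (λ j → t j * [ g j <? ∣ toℕ u - toℕ v ∣ ])
              ≤⟨ geometric ∣ toℕ u - toℕ v ∣ ⟩
            2 * r * ∣ toℕ u - toℕ v ∣
              ≡⟨ cong (2 * r *_) (*-identityˡ ∣ toℕ u - toℕ v ∣) ⟨
            2 * r * (1 * ∣ toℕ u - toℕ v ∣) ∎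
          ... | no ¬e = begin
            k * ∑ js (λ j → t j * [ no ¬e ×-dec (g j <? ∣ toℕ u - toℕ v ∣) ])
              ≡⟨ cong (k *_) (∑-cong js λ j → trans (cong (t j *_) ([]-false (no ¬e ×-dec (g j <? ∣ toℕ u - toℕ v ∣)) (¬e ∘ proj₁))) (*-zeroʳ (t j))) ⟩
            k * ∑ js (λ _ → 0)
              ≡⟨ cong (k *_) (trans (∑-allFin-const J 0) (*-zeroʳ J)) ⟩
            k * 0
              ≡⟨ *-zeroʳ k ⟩
            0
              ≤⟨ z≤n ⟩
            2 * r * (0 * ∣ toℕ u - toℕ v ∣) ∎

        -- Sum of `scale-bound` over the scales. The additional factor `k` is the one demanded by
        -- `longEdges-bound`.
        multiscale-bound : k * (k * k * (P * (J * n))) ≤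
          k * (k * k) * ∑ attacks (λ B → ∣ B⁺ B ∣) + (k * (k * k * P * ∑ js t) + P * (2 * r * edgeLengths G))
        multiscale-bound = begin
          k * (k * k * (P * (J * n)))
            ≡⟨ cong (k *_) (trans (cong (k * k *_) (lemma₁ P J n)) (trans (lemma₁ (k * k) J (P * n)) (sym (∑-allFin-const J (k * k * (P * n)))))) ⟩
          k * ∑ js (λ _ → k * k * (P * n))
            ≤⟨ *-monoʳ-≤ k (∑-mono js scale-bound) ⟩
          k * ∑ js (λ j → k * k * X j + k * k * P * t j + P * (t j * longEdges G (g j)))
            ≡⟨ cong (k *_) (trans (∑-+ js) (cong₂ _+_ (trans (∑-+ js) (cong₂ _+_ (∑-*ˡ js (k * k)) (∑-*ˡ js (k * k * P)))) (∑-*ˡ js P))) ⟩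
          k * (k * k * ∑ js X + k * k * P * ∑ js t + P * L)
            ≡⟨ lemma₂ k (∑ js X) (k * k * P * ∑ js t) P L ⟩
          k * (k * k) * ∑ js X + (k * (k * k * P * ∑ js t) + P * (k * L))
            ≤⟨ +-mono-≤ (≤-reflexive (cong (k * (k * k) *_) (sym ∑-attacks))) (+-monoʳ-≤ (k * (k * k * P * ∑ js t)) (*-monoʳ-≤ P longEdges-bound)) ⟩
          k * (k * k) * ∑ attacks (λ B → ∣ B⁺ B ∣) + (k * (k * k * P * ∑ js t) + P * (2 * r * edgeLengths G)) ∎
          where
          open ≤-Reasoning
          X = λ j → ∑ fs (λ f → ∣ B⁺ (scaleAttack j f) ∣)
          L = ∑ js (λ j → t j * longEdges G (g j))
          lemma₁ : ∀ x y z → x * (y * z) ≡ y * (x * z)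
          lemma₁ = solve-∀
          lemma₂ : ∀ k x y p l → k * (k * k * x + y + p * l) ≡ k * (k * k) * x + (k * y + p * (k * l))
          lemma₂ = solve-∀

open Combinatorics

-- Consequences of the constructive ordered field axioms.

module OrderedField (ℝ : RealNumbers) where
  open RealNumbers ℝ public hiding (zero)
  open CommutativeRing (RealNumbers.commutativeRing ℝ) using (ring; semiring; commutativeSemiring)
  open IsStrictPartialOrder <-isStrictPartialOrder public
    using (<-resp-≈) renaming (irrefl to <-irrefl; trans to <-trans; asym to <-asym)
  open Algebra.Properties.Semiring.Mult semiring using (×-homo-+; ×1-homo-*)
  open Algebra.Properties.Ring ring using (-‿involutive; -‿distribˡ-*)
  module Solver = Algebra.Solver.Ring.NaturalCoefficients.Default commutativeSemiring

  ≤-refl : ∀ {x} → x ≤ x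
  ≤-refl = <-irrefl refl

  ≤-reflexive : ∀ {x y} → x ≈ y → x ≤ y
  ≤-reflexive x≈y y<x = <-irrefl (sym x≈y) y<x

  -- As `≤` is a negated `<`, cotransitivity replaces trichotomy: a supposed `z < x` is split at
  -- `y`.
  ≤-trans : ∀ {x y z} → x ≤ y → y ≤ z → x ≤ z
  ≤-trans {y = y} x≤y y≤z z<x with <-cotrans z<x y
  ... | inj₁ z<y = y≤z z<y
  ... | inj₂ y<x = x≤y y<x

  <⇒≤ : ∀ {x y} → x < y → x ≤ y
  <⇒≤ x<y y<x = <-asym x<y y<x

  <-≤-trans : ∀ {x y z} → x < y → y ≤ z → x < z
  <-≤-trans {z = z} x<y y≤z with <-cotrans x<y z
  ... | inj₁ x<z = x<z
  ... | inj₂ z<y = contradiction z<y y≤z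

  ≤-<-trans : ∀ {x y z} → x ≤ y → y < z → x < z
  ≤-<-trans {x} x≤y y<z with <-cotrans y<z x
  ... | inj₁ y<x = contradiction y<x x≤y
  ... | inj₂ x<z = x<z

  ≤-isPreorder : IsPreorder _≈_ _≤_
  ≤-isPreorder = record { isEquivalence = isEquivalence; reflexive = ≤-reflexive; trans = ≤-trans }

  module ≤-Reasoning =
    Relation.Binary.Reasoning.Base.Triple ≤-isPreorder <-asym <-trans <-resp-≈ <⇒≤ <-≤-trans ≤-<-trans

  ≤-respˡ : ∀ {x y z} → x ≈ y → x ≤ z → y ≤ z
  ≤-respˡ x≈y = ≤-trans (≤-reflexive (sym x≈y))

  ≤-respʳ : ∀ {x y z} → x ≈ y → z ≤ x → z ≤ y
  ≤-respʳ x≈y z≤x = ≤-trans z≤x (≤-reflexive x≈y)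

  <-resp : ∀ {x y u v} → x ≈ u → y ≈ v → x < y → u < v
  <-resp x≈u y≈v x<y = proj₂ <-resp-≈ x≈u (proj₁ <-resp-≈ y≈v x<y)

  +-cancelʳ-< : ∀ z {x y} → x + z < y + z → x < y
  +-cancelʳ-< z h = <-resp (drop _) (drop _) (+-monoˡ-< (- z) h)
    where
    drop : ∀ x → x + z + - z ≈ x
    drop x = trans (+-assoc x z (- z)) (trans (+-congˡ (-‿inverseʳ z)) (+-identityʳ x))

  +-monoˡ-≤ : ∀ z {x y} → x ≤ y → x + z ≤ y + z
  +-monoˡ-≤ z x≤y h = x≤y (+-cancelʳ-< z h)

  +-monoʳ-≤ : ∀ z {x y} → x ≤ y → z + x ≤ z + y
  +-monoʳ-≤ z x≤y = ≤-respˡ (+-comm _ z) (≤-respʳ (+-comm _ z) (+-monoˡ-≤ z x≤y))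

  +-mono-≤ : ∀ {x y u v} → x ≤ y → u ≤ v → x + u ≤ y + v
  +-mono-≤ {y = y} {u} x≤y u≤v = ≤-trans (+-monoˡ-≤ u x≤y) (+-monoʳ-≤ y u≤v)

  +-cancelʳ-≤ : ∀ z {x y} → x + z ≤ y + z → x ≤ y
  +-cancelʳ-≤ z h y<x = h (+-monoˡ-< z y<x)

  *-monoʳ-< : ∀ {a x y} → 0# < a → x < y → a * x < a * y
  *-monoʳ-< {a} {x} {y} 0<a x<y = <-resp (+-identityˡ (a * x)) shift (+-monoˡ-< (a * x) (*-pos 0<a 0<y-x))
    where
    0<y-x : 0# < y + - x
    0<y-x = <-resp (-‿inverseʳ x) refl (+-monoˡ-< (- x) x<y)
    shift : a * (y + - x) + a * x ≈ a * y
    shift = trans (sym (distribˡ a (y + - x) x))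
                  (*-congˡ (trans (+-assoc y (- x) x) (trans (+-congˡ (-‿inverseˡ x)) (+-identityʳ y))))

  *-cancelˡ-≤ : ∀ {a x y} → 0# < a → a * x ≤ a * y → x ≤ y
  *-cancelˡ-≤ 0<a h y<x = h (*-monoʳ-< 0<a y<x)

  ≤-antisym : ∀ {x y} → x ≤ y → y ≤ x → x ≈ y
  ≤-antisym {x} {y} x≤y y≤x = proj₁ (tight x y) λ x#y → either (#⇒<⊎> x#y)
    where
    either : ¬ ((x < y) ⊎ (y < x))
    either (inj₁ x<y) = y≤x x<y
    either (inj₂ y<x) = x≤y y<x

  -- It is not decidable whether `a` is 0 or positive. But under the supposition `a * y < a * x` a
  -- positive `a` is absurd, so `a ≈ 0#` by antisymmetry, and both products vanish.
  *-monoʳ-≤ : ∀ {a x y} → 0# ≤ a → x ≤ y → a * x ≤ a * y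
  *-monoʳ-≤ {a} {x} {y} 0≤a x≤y ay<ax = <-irrefl ay≈ax ay<ax
    where
    a≤0 : a ≤ 0#
    a≤0 0<a = <-irrefl (*-congˡ (≤-antisym (λ x<y → <-asym (*-monoʳ-< 0<a x<y) ay<ax) x≤y)) ay<ax
    a≈0 : a ≈ 0#
    a≈0 = ≤-antisym a≤0 0≤a
    ay≈ax : a * y ≈ a * x
    ay≈ax = trans (trans (*-congʳ a≈0) (zeroˡ y)) (sym (trans (*-congʳ a≈0) (zeroˡ x)))

  *-monoˡ-≤ : ∀ {a x y} → 0# ≤ a → x ≤ y → x * a ≤ y * a
  *-monoˡ-≤ 0≤a x≤y = ≤-respˡ (*-comm _ _) (≤-respʳ (*-comm _ _) (*-monoʳ-≤ 0≤a x≤y))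

  *-nonneg : ∀ {x y} → 0# ≤ x → 0# ≤ y → 0# ≤ x * y
  *-nonneg {x} 0≤x 0≤y = ≤-respˡ (zeroʳ x) (*-monoʳ-≤ 0≤x 0≤y)

  x-0≈x : ∀ x → x + - 0# ≈ x
  x-0≈x x = trans (sym (+-identityʳ _)) (trans (+-assoc x (- 0#) 0#) (trans (+-congˡ (-‿inverseˡ 0#)) (+-identityʳ x)))

  -- 1 is invertible, hence apart from 0, and `1# < 0#` would make the square of `- 1#`, which is 1,
  -- positive.
  0<1 : 0# < 1#
  0<1 = either (#⇒<⊎> (invertible⇒# (1# , inverse , trans (*-comm _ _) inverse)))
    where
    inverse : 1# * (1# + - 0#) ≈ 1#
    inverse = trans (*-identityˡ _) (x-0≈x 1#)
    either : (1# < 0#) ⊎ (0# < 1#) → 0# < 1#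
    either (inj₂ 0<1) = 0<1
    either (inj₁ 1<0) = <-resp refl (trans (sym (-‿distribˡ-* 1# (- 1#))) (trans (-‿cong (*-identityˡ (- 1#))) (-‿involutive 1#))) (*-pos 0<-1 0<-1)
      where
      0<-1 : 0# < - 1#
      0<-1 = <-resp (-‿inverseʳ 1#) (+-identityˡ (- 1#)) (+-monoˡ-< (- 1#) 1<0)

  fromNat-+ : ∀ m n → fromNat (m ℕ.+ n) ≈ fromNat m + fromNat n
  fromNat-+ = ×-homo-+ 1#

  fromNat-* : ∀ m n → fromNat (m ℕ.* n) ≈ fromNat m * fromNat n
  fromNat-* = ×1-homo-*

  fromNat-1 : fromNat 1 ≈ 1#
  fromNat-1 = +-identityʳ 1#

  fromNat-^ : ∀ m n → fromNat (m ℕ.^ n) ≈ fromNat m ^ n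
  fromNat-^ m zero    = fromNat-1
  fromNat-^ m (suc n) = trans (fromNat-* m (m ℕ.^ n)) (*-congˡ (fromNat-^ m n))

  0≤fromNat : ∀ n → 0# ≤ fromNat n
  0≤fromNat zero    = ≤-refl
  0≤fromNat (suc n) = ≤-respˡ (+-identityʳ 0#) (+-mono-≤ (<⇒≤ 0<1) (0≤fromNat n))

  fromNat-mono-≤ : ∀ {m n} → m ℕ.≤ n → fromNat m ≤ fromNat n
  fromNat-mono-≤ {n = n} ℕ.z≤n = 0≤fromNat n
  fromNat-mono-≤ (ℕ.s≤s m≤n)   = +-monoʳ-≤ 1# (fromNat-mono-≤ m≤n)

  1≤fromNat : ∀ {n} → 1 ℕ.≤ n → 1# ≤ fromNat n
  1≤fromNat h = ≤-respˡ fromNat-1 (fromNat-mono-≤ h)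

  0<fromNat : ∀ {n} → 1 ℕ.≤ n → 0# < fromNat n
  0<fromNat h = <-≤-trans 0<1 (1≤fromNat h)

  sum-lower : ∀ n {F : Fin n → ℕ} {f : Fin n → Carrier} → (∀ i → fromNat (F i) ≤ f i) →
              fromNat (∑ (allFin n) F) ≤ sum f
  sum-lower zero            h = ≤-refl
  sum-lower (suc n) {F} {f} h = begin
    fromNat (∑ (allFin (suc n)) F)                          ≡⟨ ≡.cong fromNat (∑-allFin-suc n F) ⟩
    fromNat (F zero ℕ.+ ∑ (allFin n) (F ∘ suc))             ≈⟨ fromNat-+ (F zero) _ ⟩
    fromNat (F zero) + fromNat (∑ (allFin n) (F ∘ suc))     ≤⟨ +-mono-≤ (h zero) (sum-lower n (h ∘ suc)) ⟩
    f zero + sum (f ∘ suc)                                  ∎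
    where open ≤-Reasoning

  sum-upper : ∀ n {F : Fin n → ℕ} {f : Fin n → Carrier} → (∀ i → f i ≤ fromNat (F i)) →
              sum f ≤ fromNat (∑ (allFin n) F)
  sum-upper zero            h = ≤-refl
  sum-upper (suc n) {F} {f} h = begin
    f zero + sum (f ∘ suc)                                  ≤⟨ +-mono-≤ (h zero) (sum-upper n (h ∘ suc)) ⟩
    fromNat (F zero) + fromNat (∑ (allFin n) (F ∘ suc))     ≈⟨ fromNat-+ (F zero) _ ⟨
    fromNat (F zero ℕ.+ ∑ (allFin n) (F ∘ suc))             ≡⟨ ≡.cong fromNat (∑-allFin-suc n F) ⟨
    fromNat (∑ (allFin (suc n)) F)                          ∎
    where open ≤-Reasoning

  recip-inverse : ∀ {x} (0<x : 0# < x) → recip x 0<x * x ≈ 1#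
  recip-inverse {x} 0<x = trans (*-congˡ (sym (x-0≈x x))) (proj₁ (proj₂ (#⇒invertible (<⊎>⇒# (inj₂ 0<x)))))

  0<recip : ∀ {x} (0<x : 0# < x) → 0# < recip x 0<x
  0<recip {x} 0<x = either (#⇒<⊎> (invertible⇒# (x , trans (*-comm _ _) inverse , inverse)))
    where
    inverse : (recip x 0<x + - 0#) * x ≈ 1#
    inverse = trans (*-congʳ (x-0≈x (recip x 0<x))) (recip-inverse 0<x)
    either : (recip x 0<x < 0#) ⊎ (0# < recip x 0<x) → 0# < recip x 0<x
    either (inj₂ 0<r) = 0<r
    either (inj₁ r<0) = contradiction
      (<-resp (trans (*-comm _ _) (recip-inverse 0<x)) (zeroʳ x) (*-monoʳ-< 0<x r<0)) (<-asym 0<1)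

-- From reliability in expectation to a bound on the weight.

module Lightness (ℝ : RealNumbers) where
  open OrderedField ℝ
  open Spanners ℝ
  open Solver using (solve; _:+_; _:*_; _:=_)

  -- Domination, applied to the walk that consists of one edge, makes each weight at least the
  -- length of the edge.
  edgeLengths≤total : ∀ {n} (H : WeightedGraph n) → Dominating H →
    fromNat (edgeLengths (WeightedGraph.graph H)) ≤ fromNat 2 * WeightedGraph.total H
  edgeLengths≤total {n} H dom = begin
    fromNat (edgeLengths graph)       ≤⟨ fromNat-mono-≤ (edgeLengths≤ graph) ⟩
    fromNat (2 ℕ.* F)                 ≈⟨ fromNat-* 2 F ⟩
    fromNat 2 * fromNat F             ≤⟨ *-monoʳ-≤ (0≤fromNat 2) (sum-lower n λ u → sum-lower n (forward≤ u)) ⟩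
    fromNat 2 * total                 ∎
    where
    open WeightedGraph H
    open ≤-Reasoning
    F = ∑ (allFin n) (λ u → ∑ (allFin n) (forwardLength graph u))
    forward≤ : ∀ u v → fromNat (forwardLength graph u v) ≤
                       (if (toℕ u <ᵇ toℕ v) ∧ adj u v then weight u v else 0#)
    forward≤ u v with toℕ u <ᵇ toℕ v | adj u v in e
    ... | true  | true  = ≤-respʳ (+-identityʳ _) (dom u v (≡.subst T (≡.sym e) _ ◅ ε))
    ... | true  | false = ≤-refl
    ... | false | true  = ≤-refl
    ... | false | false = ≤-refl

  module _ {n} (D : GraphDistribution n) {ν} (0≤ν : 0# ≤ ν) (reliable : ObliviousReliable ν D) where
    open GraphDistribution D

    damage : Subset n → Ω → Subset n
    damage B = proj₁ (reliable B)

    -- Built from the operations under which `Integrable` is closed. `Integrable` is not assumed to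
    -- respect pointwise equality, so `totalDamage≈` is applied inside `𝔼-mono` only.
    totalDamage : List (Subset n) → Ω → Carrier
    totalDamage []       ω = 0#
    totalDamage (B ∷ Bs) ω = fromNat ∣ damage B ω ∣ + totalDamage Bs ω

    totalDamage≈ : ∀ Bs ω → totalDamage Bs ω ≈ fromNat (∑ Bs (λ B → ∣ damage B ω ∣))
    totalDamage≈ []       ω = refl
    totalDamage≈ (B ∷ Bs) ω = trans (+-congˡ (totalDamage≈ Bs ω)) (sym (fromNat-+ ∣ damage B ω ∣ _))

    expected-totalDamage : ∀ Bs → Σ[ i ∈ Integrable (totalDamage Bs) ] 𝔼 i ≤ (1# + ν) * fromNat (∑ Bs ∣_∣)
    expected-totalDamage []       = integrable-const 0# , ≤-reflexive (trans (𝔼-const 0#) (sym (zeroʳ _)))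
    expected-totalDamage (B ∷ Bs) with reliable B | expected-totalDamage Bs
    ... | _ , _ , _ , i , 𝔼i≤ | is , 𝔼is≤ = integrable-+ i is , (begin
      𝔼 (integrable-+ i is)                                         ≈⟨ 𝔼-+ i is ⟩
      𝔼 i + 𝔼 is                                                    ≤⟨ +-mono-≤ 𝔼i≤ 𝔼is≤ ⟩
      (1# + ν) * fromNat ∣ B ∣ + (1# + ν) * fromNat (∑ Bs ∣_∣)      ≈⟨ distribˡ (1# + ν) _ _ ⟨
      (1# + ν) * (fromNat ∣ B ∣ + fromNat (∑ Bs ∣_∣))               ≈⟨ *-congˡ (fromNat-+ ∣ B ∣ _) ⟨
      (1# + ν) * fromNat (∑ (B ∷ Bs) ∣_∣)                           ∎)
      where open ≤-Reasoning

    average : ∀ Bs {K a β} → 0# ≤ a →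
              (∀ ω → K ≤ a * fromNat (∑ Bs (λ B → ∣ damage B ω ∣)) + β) →
              K ≤ a * ((1# + ν) * fromNat (∑ Bs ∣_∣)) + β
    average Bs {K} {a} {β} 0≤a pointwise with expected-totalDamage Bs
    ... | i , 𝔼i≤ = begin
      K                                                            ≈⟨ 𝔼-const K ⟨
      𝔼 (integrable-const K)                                       ≤⟨ 𝔼-mono _ _ (λ ω → ≤-respʳ (+-congʳ (*-congˡ (sym (totalDamage≈ Bs ω)))) (pointwise ω)) ⟩
      𝔼 (integrable-+ (integrable-* a i) (integrable-const β))     ≈⟨ trans (𝔼-+ _ _) (+-cong (𝔼-* a i) (𝔼-const β)) ⟩
      a * 𝔼 i + β                                                  ≤⟨ +-monoˡ-≤ β (*-monoʳ-≤ 0≤a 𝔼i≤) ⟩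
      a * ((1# + ν) * fromNat (∑ Bs ∣_∣)) + β                      ∎
      where open ≤-Reasoning

    -- By `ckν≤e`, `1 + ν` is at most `(ck + e)/(ck)`. Divided by `ck`, `balanced` then says that
    -- `(1 + ν) dead + t + n/(ck) ≤ n`: at each scale at least `n/(ck)` vertices are, on average,
    -- left to be charged to crossings.
    module _ {k J} .{{_ : NonZero k}} (scale : Fin J → Scale n k) (r c e : ℕ) {w}
             (geometric : ∀ d → k ℕ.* ∑ (allFin J) (λ j → Scale.t (scale j) ℕ.* [ Scale.g (scale j) ℕ.<? d ]) ℕ.≤ 2 ℕ.* r ℕ.* d)
             (balanced : ∀ j → n ℕ.+ ((c ℕ.* k ℕ.+ e) ℕ.* Scale.dead (scale j) ℕ.+ c ℕ.* k ℕ.* Scale.t (scale j)) ℕ.≤ c ℕ.* k ℕ.* n)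
             (ckν≤e : fromNat (c ℕ.* k) * ν ≤ fromNat e)
             (light : ∀ ω → WeightedGraph.total (H ω) ≤ w) where
      private
        js = allFin J
        P  = k ℕ.^ n
        Q  = k ℕ.* (k ℕ.* k)
        K  = k ℕ.* (k ℕ.* k ℕ.* (P ℕ.* (J ℕ.* n)))
        Δ  = ∑ js (Scale.dead ∘ scale)
        T′ = ∑ js (λ j → Scale.t (scale j))
        N₁ = k ℕ.* (k ℕ.* k ℕ.* P ℕ.* T′)
        -- Bounds `ck` times the sum of the expected damage and `N₁`. It occurs in both `balance`
        -- and `averaged`, and cancelling it takes the place of a subtraction.
        A  = Q ℕ.* (P ℕ.* Δ) ℕ.* (c ℕ.* k ℕ.+ e) ℕ.+ c ℕ.* k ℕ.* N₁
        Bs = attacks scale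
        β  = fromNat N₁ + fromNat (P ℕ.* (2 ℕ.* r)) * (fromNat 2 * w)

      pointwise : ∀ ω → fromNat K ≤ fromNat Q * fromNat (∑ Bs (λ B → ∣ damage B ω ∣)) + β
      pointwise ω = begin
        fromNat K
          ≤⟨ fromNat-mono-≤ (multiscale-bound scale graph (λ B → damage B ω) (λ B → proj₁ (proj₂ (reliable B)) ω)
               (λ B → proj₁ (proj₂ (proj₂ (reliable B))) ω) r geometric) ⟩
        fromNat (Q ℕ.* X ℕ.+ (N₁ ℕ.+ P ℕ.* (2 ℕ.* r ℕ.* edgeLengths graph)))
          ≈⟨ trans (fromNat-+ (Q ℕ.* X) _) (+-cong (fromNat-* Q X) (fromNat-+ N₁ _)) ⟩
        fromNat Q * fromNat X + (fromNat N₁ + fromNat (P ℕ.* (2 ℕ.* r ℕ.* edgeLengths graph)))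
          ≈⟨ +-congˡ (+-congˡ (trans (reflexive (≡.cong fromNat (≡.sym (ℕ.*-assoc P (2 ℕ.* r) (edgeLengths graph))))) (fromNat-* (P ℕ.* (2 ℕ.* r)) (edgeLengths graph)))) ⟩
        fromNat Q * fromNat X + (fromNat N₁ + fromNat (P ℕ.* (2 ℕ.* r)) * fromNat (edgeLengths graph))
          ≤⟨ +-monoʳ-≤ _ (+-monoʳ-≤ _ (*-monoʳ-≤ (0≤fromNat (P ℕ.* (2 ℕ.* r))) (≤-trans (edgeLengths≤total (H ω) (dominating ω)) (*-monoʳ-≤ (0≤fromNat 2) (light ω))))) ⟩
        fromNat Q * fromNat X + β ∎
        where
        open ≤-Reasoning
        open WeightedGraph (H ω) using (graph)
        X = ∑ Bs (λ B → ∣ damage B ω ∣)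

      balance : Q ℕ.* P ℕ.* (J ℕ.* n) ℕ.+ A ℕ.≤ c ℕ.* k ℕ.* K
      balance = begin
        Q ℕ.* P ℕ.* (J ℕ.* n) ℕ.+ A
          ≡⟨ factor k P (J ℕ.* n) Δ T′ c e ⟩
        Q ℕ.* P ℕ.* (J ℕ.* n ℕ.+ ((c ℕ.* k ℕ.+ e) ℕ.* Δ ℕ.+ c ℕ.* k ℕ.* T′))
          ≤⟨ ℕ.*-monoʳ-≤ (Q ℕ.* P) summed ⟩
        Q ℕ.* P ℕ.* (J ℕ.* (c ℕ.* k ℕ.* n))
          ≡⟨ regroup k P J c n ⟩
        c ℕ.* k ℕ.* K ∎
        where
        open ℕ.≤-Reasoning
        summed : J ℕ.* n ℕ.+ ((c ℕ.* k ℕ.+ e) ℕ.* Δ ℕ.+ c ℕ.* k ℕ.* T′) ℕ.≤ J ℕ.* (c ℕ.* k ℕ.* n)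
        summed = begin
          J ℕ.* n ℕ.+ ((c ℕ.* k ℕ.+ e) ℕ.* Δ ℕ.+ c ℕ.* k ℕ.* T′)
            ≡⟨ ≡.trans (∑-+ js) (≡.cong₂ ℕ._+_ (∑-allFin-const J n) (≡.trans (∑-+ js) (≡.cong₂ ℕ._+_ (∑-*ˡ js (c ℕ.* k ℕ.+ e)) (∑-*ˡ js (c ℕ.* k))))) ⟨
          ∑ js (λ j → n ℕ.+ ((c ℕ.* k ℕ.+ e) ℕ.* Scale.dead (scale j) ℕ.+ c ℕ.* k ℕ.* Scale.t (scale j)))
            ≤⟨ ∑-mono js balanced ⟩
          ∑ js (λ _ → c ℕ.* k ℕ.* n)
            ≡⟨ ∑-allFin-const J _ ⟩
          J ℕ.* (c ℕ.* k ℕ.* n) ∎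
        factor : ∀ k p x d s c e →
          k ℕ.* (k ℕ.* k) ℕ.* p ℕ.* x ℕ.+ (k ℕ.* (k ℕ.* k) ℕ.* (p ℕ.* d) ℕ.* (c ℕ.* k ℕ.+ e) ℕ.+ c ℕ.* k ℕ.* (k ℕ.* (k ℕ.* k ℕ.* p ℕ.* s)))
          ≡ k ℕ.* (k ℕ.* k) ℕ.* p ℕ.* (x ℕ.+ ((c ℕ.* k ℕ.+ e) ℕ.* d ℕ.+ c ℕ.* k ℕ.* s))
        factor = solve-∀
        regroup : ∀ k p j c n → k ℕ.* (k ℕ.* k) ℕ.* p ℕ.* (j ℕ.* (c ℕ.* k ℕ.* n)) ≡ c ℕ.* k ℕ.* (k ℕ.* (k ℕ.* k ℕ.* (p ℕ.* (j ℕ.* n))))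
        regroup = solve-∀

      averaged : fromNat (c ℕ.* k) * fromNat K ≤
                 fromNat (c ℕ.* k) * (fromNat (P ℕ.* (2 ℕ.* r)) * (fromNat 2 * w)) + fromNat A
      averaged = begin
        ck * fromNat K
          ≤⟨ *-monoʳ-≤ (0≤fromNat (c ℕ.* k)) (average Bs (0≤fromNat Q) pointwise) ⟩
        ck * (q * ((1# + ν) * fromNat (∑ Bs ∣_∣)) + (fromNat N₁ + y))
          ≤⟨ *-monoʳ-≤ (0≤fromNat (c ℕ.* k)) (+-monoˡ-≤ _ (*-monoʳ-≤ (0≤fromNat Q) (*-monoʳ-≤ 0≤1+ν (fromNat-mono-≤ (attacks-size scale))))) ⟩
        ck * (q * ((1# + ν) * z) + (fromNat N₁ + y))
          ≈⟨ solve 7 (λ ck q o ν z s y → ck :* (q :* ((o :+ ν) :* z) :+ (s :+ y))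
                      := ck :* y :+ (q :* z :* (ck :* o :+ ck :* ν) :+ ck :* s)) refl ck q 1# ν z (fromNat N₁) y ⟩
        ck * y + (q * z * (ck * 1# + ck * ν) + ck * fromNat N₁)
          ≤⟨ +-monoʳ-≤ _ (+-monoˡ-≤ _ (*-monoʳ-≤ (*-nonneg (0≤fromNat Q) (0≤fromNat (P ℕ.* Δ))) (+-mono-≤ (≤-reflexive (*-identityʳ ck)) ckν≤e))) ⟩
        ck * y + (q * z * (ck + fromNat e) + ck * fromNat N₁)
          ≈⟨ +-congˡ (trans (fromNat-+ (Q ℕ.* (P ℕ.* Δ) ℕ.* (c ℕ.* k ℕ.+ e)) _)
               (+-cong (trans (fromNat-* (Q ℕ.* (P ℕ.* Δ)) _) (*-cong (fromNat-* Q _) (fromNat-+ (c ℕ.* k) e))) (fromNat-* (c ℕ.* k) N₁))) ⟨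
        ck * y + fromNat A ∎
        where
        open ≤-Reasoning
        ck = fromNat (c ℕ.* k)
        q  = fromNat Q
        z  = fromNat (P ℕ.* Δ)
        y  = fromNat (P ℕ.* (2 ℕ.* r)) * (fromNat 2 * w)
        0≤1+ν : 0# ≤ 1# + ν
        0≤1+ν = ≤-respˡ (+-identityʳ 0#) (+-mono-≤ (<⇒≤ 0<1) 0≤ν)

      -- Of the constant, `c` is the share of vertices charged to crossings, `2 r` comes from
      -- `geometric` and the last 2 from counting edges in both directions. The common factor
      -- `k * k ^ n` cancels.
      weight-bound : fromNat (k ℕ.* k ℕ.* (J ℕ.* n)) ≤ fromNat (c ℕ.* (2 ℕ.* r) ℕ.* 2) * w
      weight-bound = *-cancelˡ-≤ (0<fromNat (ℕ.*-mono-≤ (ℕ.>-nonZero⁻¹ k) (ℕ.m^n>0 k n))) (begin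
        fromNat (k ℕ.* P) * fromNat (k ℕ.* k ℕ.* (J ℕ.* n))
          ≈⟨ trans (reflexive (≡.cong fromNat (regroup k P (J ℕ.* n)))) (fromNat-* (k ℕ.* P) _) ⟨
        fromNat (Q ℕ.* P ℕ.* (J ℕ.* n))
          ≤⟨ +-cancelʳ-≤ (fromNat A) combined ⟩
        fromNat (c ℕ.* k) * (fromNat (P ℕ.* (2 ℕ.* r)) * (fromNat 2 * w))
          ≈⟨ *-cong (fromNat-* c k) (*-congʳ (fromNat-* P (2 ℕ.* r))) ⟩
        fromNat c * fromNat k * (fromNat P * fromNat (2 ℕ.* r) * (fromNat 2 * w))
          ≈⟨ solve 6 (λ c k p s t w → c :* k :* (p :* s :* (t :* w)) := k :* p :* (c :* s :* t :* w)) refl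
               (fromNat c) (fromNat k) (fromNat P) (fromNat (2 ℕ.* r)) (fromNat 2) w ⟩
        fromNat k * fromNat P * (fromNat c * fromNat (2 ℕ.* r) * fromNat 2 * w)
          ≈⟨ *-cong (fromNat-* k P) (*-congʳ (trans (fromNat-* (c ℕ.* (2 ℕ.* r)) 2) (*-congʳ (fromNat-* c (2 ℕ.* r))))) ⟨
        fromNat (k ℕ.* P) * (fromNat (c ℕ.* (2 ℕ.* r) ℕ.* 2) * w) ∎)
        where
        open ≤-Reasoning
        regroup : ∀ k p x → k ℕ.* (k ℕ.* k) ℕ.* p ℕ.* x ≡ k ℕ.* p ℕ.* (k ℕ.* k ℕ.* x)
        regroup = solve-∀
        combined : fromNat (Q ℕ.* P ℕ.* (J ℕ.* n)) + fromNat A ≤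
                   fromNat (c ℕ.* k) * (fromNat (P ℕ.* (2 ℕ.* r)) * (fromNat 2 * w)) + fromNat A
        combined = begin
          fromNat (Q ℕ.* P ℕ.* (J ℕ.* n)) + fromNat A    ≈⟨ fromNat-+ (Q ℕ.* P ℕ.* (J ℕ.* n)) A ⟨
          fromNat (Q ℕ.* P ℕ.* (J ℕ.* n) ℕ.+ A)          ≤⟨ fromNat-mono-≤ balance ⟩
          fromNat (c ℕ.* k ℕ.* K)                        ≈⟨ fromNat-* (c ℕ.* k) K ⟩
          fromNat (c ℕ.* k) * fromNat K                  ≤⟨ averaged ⟩
          fromNat (c ℕ.* k) * (fromNat (P ℕ.* (2 ℕ.* r)) * (fromNat 2 * w)) + fromNat A ∎

-- The path graph as a spanning tree, and the weight of the minimum spanning tree.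

suc≢ᵇ : ∀ n → (suc n ≡ᵇ n) ≡ false
suc≢ᵇ zero    = ≡.refl
suc≢ᵇ (suc n) = suc≢ᵇ n

pathGraph : ∀ n → Graph n
pathGraph n = record
  { adj        = λ u v → (suc (toℕ u) ≡ᵇ toℕ v) ∨ (suc (toℕ v) ≡ᵇ toℕ u)
  ; adj-sym    = λ u v → ∨-comm (suc (toℕ u) ≡ᵇ toℕ v) _
  ; adj-irrefl = λ u → ≡.cong₂ _∨_ (suc≢ᵇ (toℕ u)) (suc≢ᵇ (toℕ u))
  }

module _ {n : ℕ} where
  open Graph (pathGraph n)

  edge⇒ : ∀ u v → Edge u v → suc (toℕ u) ≡ toℕ v ⊎ suc (toℕ v) ≡ toℕ u
  edge⇒ u v e with Equivalence.to (T-∨ {suc (toℕ u) ≡ᵇ toℕ v}) e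
  ... | inj₁ p = inj₁ (ℕ.≡ᵇ⇒≡ _ _ p)
  ... | inj₂ p = inj₂ (ℕ.≡ᵇ⇒≡ _ _ p)

  edge⇐ : ∀ u v → suc (toℕ v) ≡ toℕ u → Edge u v
  edge⇐ u v eq = Equivalence.from (T-∨ {suc (toℕ u) ≡ᵇ toℕ v}) (inj₂ (ℕ.≡⇒≡ᵇ _ _ eq))

  -- Two consecutive steps in opposite directions would revisit a vertex.
  straight : ∀ {k} (R : ℕ → ℕ → Set) → (∀ {x y z} → R x y → R z y → x ≡ z) →
             (c : Fin (3 ℕ.+ k) → Fin n) → Injective _≡_ _≡_ c →
             (∀ i → R (toℕ (c (inject₁ i))) (toℕ (c (suc i))) ⊎ R (toℕ (c (suc i))) (toℕ (c (inject₁ i)))) →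
             R (toℕ (c zero)) (toℕ (c (suc zero))) →
             ∀ i → R (toℕ (c (inject₁ i))) (toℕ (c (suc i)))
  straight R unique c inj step first = <-weakInduction _ first next
    where
    next : ∀ i → R (toℕ (c (inject₁ (inject₁ i)))) (toℕ (c (suc (inject₁ i)))) →
                 R (toℕ (c (inject₁ (suc i)))) (toℕ (c (suc (suc i))))
    next i prev with step (suc i)
    ... | inj₁ forth = forth
    ... | inj₂ back  = contradiction (≡.cong toℕ (inj (toℕ-injective (unique back prev)))) λ eq →
      ℕ.m≢1+n+m (toℕ i) {1} (≡.sym (≡.trans eq (≡.trans (toℕ-inject₁ (inject₁ i)) (toℕ-inject₁ i))))

  ascending : ∀ {k} (f : Fin (suc k) → ℕ) → (∀ i → suc (f (inject₁ i)) ≡ f (suc i)) → ∀ i → f i ≡ toℕ i ℕ.+ f zero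
  ascending f step = <-weakInduction _ ≡.refl
    λ i ih → ≡.trans (≡.sym (step i)) (≡.cong suc (≡.trans ih (≡.cong (ℕ._+ f zero) (toℕ-inject₁ i))))

  descending : ∀ {k} (f : Fin (suc k) → ℕ) → (∀ i → suc (f (suc i)) ≡ f (inject₁ i)) → ∀ i → toℕ i ℕ.+ f i ≡ f zero
  descending f step = <-weakInduction _ ≡.refl
    λ i ih → ≡.trans (≡.trans (≡.sym (ℕ.+-suc (toℕ i) (f (suc i)))) (≡.cong₂ ℕ._+_ (≡.sym (toℕ-inject₁ i)) (step i))) ih

  -- By `straight` a cycle rises or falls by 1 at every step, so its ends differ by `2 + k`, too
  -- much for the closing edge.
  path-acyclic : ¬ Cycle
  path-acyclic (k , c , inj , step , close) with edge⇒ _ _ (step zero)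
  ... | inj₁ up = last≢ (edge⇒ _ _ close)
    where
    last≡ : toℕ (c (fromℕ (2 ℕ.+ k))) ≡ 2 ℕ.+ k ℕ.+ toℕ (c zero)
    last≡ = ≡.trans (ascending (toℕ ∘ c) (straight (λ x y → suc x ≡ y) (λ p q → ℕ.suc-injective (≡.trans p (≡.sym q))) c inj (λ i → edge⇒ _ _ (step i)) up) (fromℕ (2 ℕ.+ k)))
                    (≡.cong (ℕ._+ toℕ (c zero)) (toℕ-fromℕ (2 ℕ.+ k)))
    last≢ : ¬ (suc (toℕ (c (fromℕ (2 ℕ.+ k)))) ≡ toℕ (c zero) ⊎ suc (toℕ (c zero)) ≡ toℕ (c (fromℕ (2 ℕ.+ k))))
    last≢ (inj₁ p) = ℕ.m≢1+n+m (toℕ (c zero)) {2 ℕ.+ k} (≡.sym (≡.trans (≡.cong suc (≡.sym last≡)) p))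
    last≢ (inj₂ p) = ℕ.m≢1+n+m (toℕ (c zero)) {k} (ℕ.suc-injective (≡.trans p last≡))
  ... | inj₂ down = last≢ (edge⇒ _ _ close)
    where
    last≡ : 2 ℕ.+ k ℕ.+ toℕ (c (fromℕ (2 ℕ.+ k))) ≡ toℕ (c zero)
    last≡ = ≡.trans (≡.cong (ℕ._+ toℕ (c (fromℕ (2 ℕ.+ k)))) (≡.sym (toℕ-fromℕ (2 ℕ.+ k))))
                    (descending (toℕ ∘ c) (straight (λ x y → suc y ≡ x) (λ p q → ≡.trans (≡.sym p) q) c inj (λ i → swap (edge⇒ _ _ (step i))) down) (fromℕ (2 ℕ.+ k)))
    last≢ : ¬ (suc (toℕ (c (fromℕ (2 ℕ.+ k)))) ≡ toℕ (c zero) ⊎ suc (toℕ (c zero)) ≡ toℕ (c (fromℕ (2 ℕ.+ k))))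
    last≢ (inj₁ p) = ℕ.m≢1+n+m (toℕ (c (fromℕ (2 ℕ.+ k)))) {k} (ℕ.suc-injective (≡.trans p (≡.sym last≡)))
    last≢ (inj₂ p) = ℕ.m≢1+n+m (toℕ (c (fromℕ (2 ℕ.+ k)))) {2 ℕ.+ k} (≡.trans (≡.sym p) (≡.cong suc (≡.sym last≡)))

path-connected : ∀ n → Graph.Connected (pathGraph n)
path-connected (suc n) u v = to-zero u ◅◅ reverse (λ {x} {y} → ≡.subst T (adj-sym x y)) (to-zero v)
  where
  open Graph (pathGraph (suc n))
  to-zero : ∀ u → Walk u zero
  to-zero = <-weakInduction (λ u → Walk u zero) ε
    λ i walk → edge⇐ (suc i) (inject₁ i) (≡.cong suc (toℕ-inject₁ i)) ◅ walk

module PathWeight (ℝ : RealNumbers) where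
  open OrderedField ℝ
  open Spanners ℝ

  -- Each vertex has at most one successor, at distance 1; granting one to the last vertex as well
  -- gives `n` in place of `n - 1`.
  path-weight : ∀ n → totalWeight (pathGraph n) dX ≤ fromNat n
  path-weight n = begin
    totalWeight (pathGraph n) dX                                                    ≤⟨ sum-upper n (λ u → sum-upper n (step≤ u)) ⟩
    fromNat (∑ (allFin n) λ u → ∑ (allFin n) λ v → [ toℕ v ℕ.≟ suc (toℕ u) ])      ≤⟨ fromNat-mono-≤ (∑-mono (allFin n) λ u → ∑-point n (suc (toℕ u))) ⟩
    fromNat (∑ (allFin n) λ _ → 1)                                                 ≡⟨ ≡.cong fromNat (≡.trans (∑-allFin-const n 1) (ℕ.*-identityʳ n)) ⟩
    fromNat n                                                                       ∎
    where
    open ≤-Reasoning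
    open Graph (pathGraph n)
    step≤ : ∀ u v → (if (toℕ u <ᵇ toℕ v) ∧ adj u v then dX u v else 0#) ≤ fromNat [ toℕ v ℕ.≟ suc (toℕ u) ]
    step≤ u v with toℕ u <ᵇ toℕ v in lt | adj u v in e
    ... | false | true  = 0≤fromNat [ toℕ v ℕ.≟ suc (toℕ u) ]
    ... | false | false = 0≤fromNat [ toℕ v ℕ.≟ suc (toℕ u) ]
    ... | true  | false = 0≤fromNat [ toℕ v ℕ.≟ suc (toℕ u) ]
    ... | true  | true  with edge⇒ u v (≡.subst T (≡.sym e) tt)
    ...   | inj₂ v<u = contradiction (ℕ.<ᵇ⇒< (toℕ u) (toℕ v) (≡.subst T (≡.sym lt) tt))
                                     (ℕ.<⇒≯ (ℕ.≤-reflexive v<u))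
    ...   | inj₁ u+1≡v = fromNat-mono-≤ (ℕ.≤-trans (ℕ.≤-reflexive distance≡1) ([]≥1 (toℕ v ℕ.≟ suc (toℕ u)) (≡.sym u+1≡v)))
      where
      distance≡1 : ℕ.∣ toℕ u - toℕ v ∣ ≡ 1
      distance≡1 = ≡.trans (≡.cong ℕ.∣ toℕ u -_∣ (≡.trans (≡.sym u+1≡v) (ℕ.+-comm 1 (toℕ u)))) (ℕ.∣m-m+n∣≡n (toℕ u) 1)

  mst-weight≤n : ∀ {n} (S : Graph n) → IsMST S → totalWeight S dX ≤ fromNat n
  mst-weight≤n {n} S (_ , minimal) =
    ≤-trans (minimal (pathGraph n) (path-connected n , path-acyclic)) (path-weight n)

  0≤mst-weight : ∀ {n} (S : Graph n) → 0# ≤ totalWeight S dX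
  0≤mst-weight {n} S = ≤-trans (0≤fromNat (∑ (allFin n) zeros)) (sum-lower n {zeros} λ u → sum-lower n (step≥ u))
    where
    zeros : Fin n → ℕ
    zeros _ = ∑ (allFin n) λ _ → 0
    step≥ : ∀ u v → 0# ≤ (if (toℕ u <ᵇ toℕ v) ∧ Graph.adj S u v then dX u v else 0#)
    step≥ u v with (toℕ u <ᵇ toℕ v) ∧ Graph.adj S u v
    ... | true  = 0≤fromNat ℕ.∣ toℕ u - toℕ v ∣
    ... | false = ≤-refl

-- Dyadic scales and their budgets.

-- Downward search for the least `J` with `n < C * 2 ^ J`, about `log₂ (n / C)`; it starts from
-- `n < 2 ^ n`.
scaleCount : ∀ C n .{{_ : NonZero C}} → ∃[ J ] (∀ j → j ℕ.< J → C ℕ.* 2 ℕ.^ j ℕ.≤ n) × n ℕ.< C ℕ.* 2 ℕ.^ J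
scaleCount C n = below n n<C2^n
  where
  below : ∀ N → n ℕ.< C ℕ.* 2 ℕ.^ N → ∃[ J ] (∀ j → j ℕ.< J → C ℕ.* 2 ℕ.^ j ℕ.≤ n) × n ℕ.< C ℕ.* 2 ℕ.^ J
  below zero    n<  = 0 , (λ _ ()) , n<
  below (suc N) n<  with n ℕ.<? C ℕ.* 2 ℕ.^ N
  ... | yes n<′ = below N n<′
  ... | no  n≮  = suc N , (λ j j<J → ℕ.≤-trans (ℕ.*-monoʳ-≤ C (ℕ.^-monoʳ-≤ 2 (ℕ.m<1+n⇒m≤n j<J))) (ℕ.≮⇒≥ n≮)) , n<
  n<2^n : ∀ n → n ℕ.< 2 ℕ.^ n
  n<2^n zero    = ℕ.z<s
  n<2^n (suc n) = ℕ.+-mono-≤ (ℕ.m^n>0 2 n) (ℕ.≤-trans (n<2^n n) (ℕ.≤-reflexive (≡.sym (ℕ.+-identityʳ _))))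
  n<C2^n : n ℕ.< C ℕ.* 2 ℕ.^ n
  n<C2^n = ℕ.≤-trans (n<2^n n) (ℕ.m≤n*m (2 ℕ.^ n) C)

module _ (n k r : ℕ) .{{_ : NonZero k}} .{{_ : NonZero r}} where

  -- The factor `r` lengthens the slots in proportion to the gaps: 1 for small `ν`, 16 for `ν`
  -- bounded below.
  dyadicScale : ℕ → Scale n k
  dyadicScale j = record { t = t ; g = g ; m = n / (g ℕ.+ k ℕ.* t) ; fits = m/n*n≤m n (g ℕ.+ k ℕ.* t) }
    where
    t g : ℕ
    t = r ℕ.* 2 ℕ.^ j
    g = k ℕ.* 2 ℕ.^ j
    instance
      2^j≢0 : NonZero (2 ℕ.^ j)
      2^j≢0 = ℕ.m^n≢0 2 j
      t≢0 : NonZero t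
      t≢0 = ℕ.m*n≢0 r (2 ℕ.^ j)
      b≢0 : NonZero (g ℕ.+ k ℕ.* t)
      b≢0 = Layout.b≢0 k t g 0

  dyadic-geometric : ∀ {J} d →
    k ℕ.* ∑ (allFin J) (λ j → Scale.t (dyadicScale (toℕ j)) ℕ.* [ Scale.g (dyadicScale (toℕ j)) ℕ.<? d ]) ℕ.≤ 2 ℕ.* r ℕ.* d
  dyadic-geometric {J} d = begin
    k ℕ.* ∑ (allFin J) (λ j → r ℕ.* 2 ℕ.^ toℕ j ℕ.* [ k ℕ.* 2 ℕ.^ toℕ j ℕ.<? d ])
      ≡⟨ ≡.cong (k ℕ.*_) (∑-allFin-toℕ J) ⟩
    k ℕ.* ∑ (upTo J) (λ j → r ℕ.* 2 ℕ.^ j ℕ.* [ k ℕ.* 2 ℕ.^ j ℕ.<? d ])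
      ≡⟨ ≡.cong (k ℕ.*_) (≡.trans (∑-cong (upTo J) λ j → ℕ.*-assoc r (2 ℕ.^ j) _) (∑-*ˡ (upTo J) r)) ⟩
    k ℕ.* (r ℕ.* ∑ (upTo J) (λ j → 2 ℕ.^ j ℕ.* [ k ℕ.* 2 ℕ.^ j ℕ.<? d ]))
      ≡⟨ regroup k r _ ⟩
    r ℕ.* (k ℕ.* ∑ (upTo J) (λ j → 2 ℕ.^ j ℕ.* [ k ℕ.* 2 ℕ.^ j ℕ.<? d ]))
      ≤⟨ ℕ.*-monoʳ-≤ r (∑-geometric k d J) ⟩
    r ℕ.* (2 ℕ.* d)
      ≡⟨ regroup′ r d ⟩
    2 ℕ.* r ℕ.* d ∎
    where
    open ℕ.≤-Reasoning
    regroup : ∀ k r x → k ℕ.* (r ℕ.* x) ≡ r ℕ.* (k ℕ.* x)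
    regroup = solve-∀
    regroup′ : ∀ r d → r ℕ.* (2 ℕ.* d) ≡ 2 ℕ.* r ℕ.* d
    regroup′ = solve-∀

n<[1+n/b]*b : ∀ n b .{{_ : NonZero b}} → n ℕ.< suc (n / b) ℕ.* b
n<[1+n/b]*b n b = ℕ.≤-trans (ℕ.s≤s (ℕ.≤-reflexive (m≡m%n+[m/n]*n n b))) (ℕ.+-monoˡ-≤ _ (m%n<n n b))

a*b≤n⇒a≤n/b : ∀ {a} n b .{{_ : NonZero b}} → a ℕ.* b ℕ.≤ n → a ℕ.≤ n / b
a*b≤n⇒a≤n/b {a} n b h = ℕ.m<1+n⇒m≤n (ℕ.*-cancelʳ-< b a (suc (n / b)) (ℕ.≤-<-trans h (n<[1+n/b]*b n b)))

module _ {n k} .{{_ : NonZero k}} (s : Scale n k) where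
  open Scale s

  dead+alive : m ℕ.* t ℕ.+ dead ≡ n
  dead+alive = ℕ.m+[n∸m]≡n (ℕ.≤-trans (ℕ.*-monoʳ-≤ m (ℕ.≤-trans (ℕ.m≤n*m t k) (ℕ.m≤n+m (k ℕ.* t) g))) fits)

-- b = 2 k t and m ≥ 2, so at least n / 4k vertices survive.
sparse-balanced : ∀ n k j .{{_ : NonZero k}} → 4 ℕ.* k ℕ.* 2 ℕ.^ j ℕ.≤ n → let open Scale (dyadicScale n k 1 j) in
  n ℕ.+ ((16 ℕ.* k ℕ.+ 1) ℕ.* dead ℕ.+ 16 ℕ.* k ℕ.* t) ℕ.≤ 16 ℕ.* k ℕ.* n
sparse-balanced n k j h = begin
  n ℕ.+ ((16 ℕ.* k ℕ.+ 1) ℕ.* dead ℕ.+ 16 ℕ.* k ℕ.* t)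
    ≡⟨ expand n k dead t ⟩
  16 ℕ.* k ℕ.* dead ℕ.+ (n ℕ.+ dead ℕ.+ 8 ℕ.* k ℕ.* (2 ℕ.* t))
    -- Origin of the constant 16: measured in `k * (m * t)`, the terms `n`, `dead ≤ n` and `16 k t`
    -- cost at most 4, 4 and 8.
    ≤⟨ ℕ.+-monoʳ-≤ (16 ℕ.* k ℕ.* dead) (ℕ.+-mono-≤ (ℕ.+-monoʳ-≤ n (ℕ.m∸n≤m n (m ℕ.* t))) (ℕ.*-monoʳ-≤ (8 ℕ.* k) (ℕ.*-monoˡ-≤ t 2≤m))) ⟩
  16 ℕ.* k ℕ.* dead ℕ.+ (n ℕ.+ n ℕ.+ 8 ℕ.* k ℕ.* (m ℕ.* t))
    ≤⟨ ℕ.+-monoʳ-≤ (16 ℕ.* k ℕ.* dead) (ℕ.+-monoˡ-≤ (8 ℕ.* k ℕ.* (m ℕ.* t)) (ℕ.+-mono-≤ n≤ n≤)) ⟩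
  16 ℕ.* k ℕ.* dead ℕ.+ (4 ℕ.* k ℕ.* (m ℕ.* t) ℕ.+ 4 ℕ.* k ℕ.* (m ℕ.* t) ℕ.+ 8 ℕ.* k ℕ.* (m ℕ.* t))
    ≡⟨ collect k dead (m ℕ.* t) ⟩
  16 ℕ.* k ℕ.* (m ℕ.* t ℕ.+ dead)
    ≡⟨ ≡.cong (16 ℕ.* k ℕ.*_) (dead+alive s) ⟩
  16 ℕ.* k ℕ.* n ∎
  where
  open ℕ.≤-Reasoning
  s = dyadicScale n k 1 j
  open Scale s
  b = g ℕ.+ k ℕ.* t
  instance
    t≢0′ : NonZero t
    t≢0′ = t≢0
    b≢0 : NonZero b
    b≢0 = Layout.b≢0 k t g 0
  b≡ : ∀ k x → k ℕ.* x ℕ.+ k ℕ.* (1 ℕ.* x) ≡ 2 ℕ.* k ℕ.* x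
  b≡ = solve-∀
  2≤m : 2 ℕ.≤ m
  2≤m = a*b≤n⇒a≤n/b n b (ℕ.≤-trans (ℕ.≤-reflexive (≡.trans (≡.cong (2 ℕ.*_) (b≡ k (2 ℕ.^ j))) (double k (2 ℕ.^ j)))) h)
    where
    double : ∀ k x → 2 ℕ.* (2 ℕ.* k ℕ.* x) ≡ 4 ℕ.* k ℕ.* x
    double = solve-∀
  n≤ : n ℕ.≤ 4 ℕ.* k ℕ.* (m ℕ.* t)
  n≤ = begin
    n                                  ≤⟨ ℕ.<⇒≤ (n<[1+n/b]*b n b) ⟩
    suc m ℕ.* b                        ≤⟨ ℕ.*-monoˡ-≤ b (ℕ.+-monoˡ-≤ m (ℕ.≤-trans (ℕ.s≤s ℕ.z≤n) 2≤m)) ⟩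
    (m ℕ.+ m) ℕ.* b                    ≡⟨ regroup m k (2 ℕ.^ j) ⟩
    4 ℕ.* k ℕ.* (m ℕ.* t)              ∎
    where
    regroup : ∀ m k x → (m ℕ.+ m) ℕ.* (k ℕ.* x ℕ.+ k ℕ.* (1 ℕ.* x)) ≡ 4 ℕ.* k ℕ.* (m ℕ.* (1 ℕ.* x))
    regroup = solve-∀
  expand : ∀ n k d t → n ℕ.+ ((16 ℕ.* k ℕ.+ 1) ℕ.* d ℕ.+ 16 ℕ.* k ℕ.* t) ≡ 16 ℕ.* k ℕ.* d ℕ.+ (n ℕ.+ d ℕ.+ 8 ℕ.* k ℕ.* (2 ℕ.* t))
  expand = solve-∀
  collect : ∀ k d x → 16 ℕ.* k ℕ.* d ℕ.+ (4 ℕ.* k ℕ.* x ℕ.+ 4 ℕ.* k ℕ.* x ℕ.+ 8 ℕ.* k ℕ.* x) ≡ 16 ℕ.* k ℕ.* (x ℕ.+ d)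
  collect = solve-∀

-- For ν bounded below a single slot per block (k = 1) is kept: 16/17 of every block
-- survives and only the gaps are attacked.
dense-balanced : ∀ n j → 64 ℕ.* 2 ℕ.^ j ℕ.≤ n → let open Scale (dyadicScale n 1 16 j) in
  n ℕ.+ ((16 ℕ.* 1 ℕ.+ 16) ℕ.* dead ℕ.+ 16 ℕ.* 1 ℕ.* t) ℕ.≤ 16 ℕ.* 1 ℕ.* n
dense-balanced n j h = ℕ.+-cancelʳ-≤ (32 ℕ.* (m ℕ.* t)) _ _ (begin
  n ℕ.+ (32 ℕ.* dead ℕ.+ 16 ℕ.* t) ℕ.+ 32 ℕ.* (m ℕ.* t)
    ≡⟨ collect n dead t (m ℕ.* t) ⟩
  n ℕ.+ 32 ℕ.* (m ℕ.* t ℕ.+ dead) ℕ.+ 16 ℕ.* t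
    ≡⟨ ≡.cong (λ x → n ℕ.+ 32 ℕ.* x ℕ.+ 16 ℕ.* t) (dead+alive s) ⟩
  n ℕ.+ 32 ℕ.* n ℕ.+ 16 ℕ.* t
    ≡⟨ split n t ⟩
  16 ℕ.* n ℕ.+ (17 ℕ.* n ℕ.+ 16 ℕ.* t)
    ≤⟨ ℕ.+-monoʳ-≤ (16 ℕ.* n) (begin
      17 ℕ.* n ℕ.+ 16 ℕ.* t
        ≤⟨ ℕ.+-monoˡ-≤ (16 ℕ.* t) (ℕ.*-monoʳ-≤ 17 (ℕ.<⇒≤ (n<[1+n/b]*b n b))) ⟩
      17 ℕ.* (suc m ℕ.* b) ℕ.+ 16 ℕ.* t
        ≡⟨ numbers m x ⟩
      (289 ℕ.* m ℕ.+ 545) ℕ.* x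
        -- The target is `512 m x` and `289 = 17 * 17`, which leaves `223 m` for `545 = 289 + 256`;
        -- three blocks suffice, as `3 * 223 = 669`.
        ≤⟨ ℕ.*-monoˡ-≤ x (ℕ.+-monoʳ-≤ (289 ℕ.* m) (ℕ.≤-trans (ℕ.m≤m+n 545 124) (ℕ.*-monoʳ-≤ 223 3≤m))) ⟩
      (289 ℕ.* m ℕ.+ 223 ℕ.* m) ℕ.* x
        ≡⟨ numbers′ m x ⟩
      32 ℕ.* (m ℕ.* t) ∎) ⟩
  16 ℕ.* n ℕ.+ 32 ℕ.* (m ℕ.* t) ∎)
  where
  open ℕ.≤-Reasoning
  s = dyadicScale n 1 16 j
  open Scale s
  x = 2 ℕ.^ j
  b = g ℕ.+ 1 ℕ.* t
  instance
    t≢0′ : NonZero t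
    t≢0′ = t≢0
    b≢0 : NonZero b
    b≢0 = Layout.b≢0 1 t g 0
  3≤m : 3 ℕ.≤ m
  3≤m = a*b≤n⇒a≤n/b n b (ℕ.≤-trans (ℕ.≤-reflexive (triple x)) (ℕ.≤-trans (ℕ.*-monoˡ-≤ x (ℕ.m≤m+n 51 13)) h))
    where
    triple : ∀ x → 3 ℕ.* (1 ℕ.* x ℕ.+ 1 ℕ.* (16 ℕ.* x)) ≡ 51 ℕ.* x
    triple = solve-∀
  collect : ∀ n d t y → n ℕ.+ (32 ℕ.* d ℕ.+ 16 ℕ.* t) ℕ.+ 32 ℕ.* y ≡ n ℕ.+ 32 ℕ.* (y ℕ.+ d) ℕ.+ 16 ℕ.* t
  collect = solve-∀
  split : ∀ n t → n ℕ.+ 32 ℕ.* n ℕ.+ 16 ℕ.* t ≡ 16 ℕ.* n ℕ.+ (17 ℕ.* n ℕ.+ 16 ℕ.* t)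
  split = solve-∀
  numbers : ∀ m x → 17 ℕ.* (suc m ℕ.* (1 ℕ.* x ℕ.+ 1 ℕ.* (16 ℕ.* x))) ℕ.+ 16 ℕ.* (16 ℕ.* x) ≡ (289 ℕ.* m ℕ.+ 545) ℕ.* x
  numbers = solve-∀
  numbers′ : ∀ m x → (289 ℕ.* m ℕ.+ 223 ℕ.* m) ℕ.* x ≡ 32 ℕ.* (m ℕ.* (16 ℕ.* x))
  numbers′ = solve-∀

-- Choice of `k` and the final lower bound.

-- A discrete intermediate value search in which `L` and `H` may overlap: go up while the answer is
-- `L`; the first answer `H`, or the given end, stops the search.
switch : ∀ {L H : ℕ → Set} → (∀ i → L i ⊎ H i) → ∀ N {k} → L k → H (suc (N ℕ.+ k)) →
         ∃[ i ] k ℕ.≤ i × L i × H (suc i)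
switch         dec zero    {k} low high = k , ℕ.≤-refl , low , high
switch {H = H} dec (suc N) {k} low high with dec (suc k)
... | inj₂ high′ = k , ℕ.≤-refl , low , high′
... | inj₁ low′ with switch dec N low′ (≡.subst (H ∘ suc) (≡.sym (ℕ.+-suc N k)) high)
...   | i , k<i , rest = i , ℕ.<⇒≤ k<i , rest

module LowerBound (ℝ : RealNumbers) where
  open OrderedField ℝ
  open Spanners ℝ
  open Lightness ℝ
  open PathWeight ℝ
  open Solver using (solve; _:+_; _:*_; _:=_)

  -- The definition of the logarithm at the exponent `(M - 0) / 1`: `M < L` would give `2 ^ M < x`.
  log₂≤ : ∀ {x L} M → IsLog₂ x L → x ≤ fromNat (2 ℕ.^ M) → L ≤ fromNat M
  log₂≤ {x} {L} M log x≤2^M M<L = x≤2^M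
    (<-resp (sym (fromNat-^ 2 M)) (trans (*-identityˡ _) (*-identityʳ x))
      (proj₁ (log M 0 1 ℕ.z<s) (<-resp refl (sym (trans (+-identityˡ _) (trans (*-congʳ fromNat-1) (*-identityˡ L)))) M<L)))

  -- k is an integer approximation of 1/ν, up to a constant factor.
  record Witness (n : ℕ) (ν φ : Carrier) : Set where
    field
      k M      : ℕ
      1≤64kν   : 1# ≤ fromNat (64 ℕ.* k) * ν
      nν≤2^M   : fromNat n * ν ≤ fromNat (2 ℕ.^ M)
      k²M≤φ    : fromNat (k ℕ.* k ℕ.* M) ≤ fromNat 2048 * φ

  -- The two factors 64 come from `1/ν ≤ 64k`, used twice, and 2048 from `k²M≤φ`.
  constant : Carrier
  constant = fromNat 64 * (fromNat 64 * fromNat 2048)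

  0<constant : 0# < constant
  0<constant = *-pos (0<fromNat {64} (ℕ.s≤s ℕ.z≤n)) (*-pos (0<fromNat {64} (ℕ.s≤s ℕ.z≤n)) (0<fromNat {2048} (ℕ.s≤s ℕ.z≤n)))

  witness⇒bound : ∀ {n ν φ} (0<ν : 0# < ν) → Witness n ν φ → ∀ {L} → IsLog₂ (fromNat n * ν) L →
                  recip constant 0<constant * (recip ν 0<ν ^ 2 * L) ≤ φ
  witness⇒bound {n} {ν} {φ} 0<ν wit {L} log = *-cancelˡ-≤ 0<constant (begin
    constant * (recip constant 0<constant * (ρ ^ 2 * L))
      ≈⟨ trans (sym (*-assoc _ _ _)) (trans (*-congʳ (trans (*-comm _ _) (recip-inverse 0<constant))) (*-identityˡ _)) ⟩
    ρ ^ 2 * L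
      -- `L` may be negative; it is `ρ ^ 2` that has to be nonnegative.
      ≤⟨ *-monoʳ-≤ (*-nonneg 0≤ρ (*-nonneg 0≤ρ (<⇒≤ 0<1))) (log₂≤ M log nν≤2^M) ⟩
    ρ ^ 2 * fromNat M
      ≈⟨ *-congʳ (*-congˡ (*-identityʳ ρ)) ⟩
    ρ * ρ * fromNat M
      ≤⟨ *-monoˡ-≤ (0≤fromNat M) (≤-trans (*-monoˡ-≤ 0≤ρ ρ≤64k) (*-monoʳ-≤ (0≤fromNat (64 ℕ.* k)) ρ≤64k)) ⟩
    fromNat (64 ℕ.* k) * fromNat (64 ℕ.* k) * fromNat M
      ≈⟨ *-congʳ (*-cong (fromNat-* 64 k) (fromNat-* 64 k)) ⟩
    fromNat 64 * fromNat k * (fromNat 64 * fromNat k) * fromNat M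
      ≈⟨ solve 3 (λ c k m → c :* k :* (c :* k) :* m := c :* (c :* (k :* k :* m))) refl (fromNat 64) (fromNat k) (fromNat M) ⟩
    fromNat 64 * (fromNat 64 * (fromNat k * fromNat k * fromNat M))
      ≈⟨ *-congˡ (*-congˡ (trans (fromNat-* (k ℕ.* k) M) (*-congʳ (fromNat-* k k)))) ⟨
    fromNat 64 * (fromNat 64 * fromNat (k ℕ.* k ℕ.* M))
      ≤⟨ *-monoʳ-≤ (0≤fromNat 64) (*-monoʳ-≤ (0≤fromNat 64) k²M≤φ) ⟩
    fromNat 64 * (fromNat 64 * (fromNat 2048 * φ))
      ≈⟨ trans (*-congˡ (sym (*-assoc _ _ _))) (sym (*-assoc _ _ _)) ⟩
    constant * φ ∎)
    where
    open Witness wit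
    open ≤-Reasoning
    ρ = recip ν 0<ν
    0≤ρ : 0# ≤ ρ
    0≤ρ = <⇒≤ (0<recip 0<ν)
    ρ≤64k : ρ ≤ fromNat (64 ℕ.* k)
    ρ≤64k = begin
      ρ                                     ≈⟨ *-identityʳ ρ ⟨
      ρ * 1#                                ≤⟨ *-monoʳ-≤ 0≤ρ 1≤64kν ⟩
      ρ * (fromNat (64 ℕ.* k) * ν)          ≈⟨ solve 3 (λ r a v → r :* (a :* v) := a :* (r :* v)) refl ρ (fromNat (64 ℕ.* k)) ν ⟩
      fromNat (64 ℕ.* k) * (ρ * ν)          ≈⟨ trans (*-congˡ (recip-inverse 0<ν)) (*-identityʳ _) ⟩
      fromNat (64 ℕ.* k)                    ∎

  module _ {n} (2≤n : 2 ℕ.≤ n) {ν} (0<ν : 0# < ν) (ν<1 : ν < 1#) (D : GraphDistribution n) (reliable : ObliviousReliable ν D)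
           {φ} (lightness : HasLightness D φ) where
    private
      S = proj₁ lightness
      W = totalWeight S dX

      0≤W : 0# ≤ W
      0≤W = 0≤mst-weight S

      W≤n : W ≤ fromNat n
      W≤n = mst-weight≤n S (proj₁ (proj₂ lightness))

      0<n : 0# < fromNat n
      0<n = 0<fromNat (ℕ.≤-trans (ℕ.s≤s ℕ.z≤n) 2≤n)

      16ν≤16 : fromNat (16 ℕ.* 1) * ν ≤ fromNat 16
      16ν≤16 = ≤-respʳ (*-identityʳ _) (*-monoʳ-≤ (0≤fromNat 16) (<⇒≤ ν<1))

    -- The scale at which nothing is attacked: B = ∅.
    trivialScale : Fin 1 → Scale n 1
    trivialScale _ = record { t = 1 ; g = 0 ; m = n ; fits = ℕ.≤-reflexive (ℕ.*-identityʳ n) }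

    -- With `B` empty the expected damage is 0, so `H` must join all vertices, and crossings are
    -- edges of positive length. The budget reduces to `n + 16 ≤ 16n`, which holds for `n ≥ 2`.
    n≤64φW : fromNat (1 ℕ.* 1 ℕ.* (1 ℕ.* n)) ≤ fromNat (16 ℕ.* (2 ℕ.* 1) ℕ.* 2) * (φ * W)
    n≤64φW = weight-bound D (<⇒≤ 0<ν) reliable trivialScale 1 16 16 geometric balanced 16ν≤16 (proj₂ (proj₂ lightness))
      where
      geometric : ∀ d → 1 ℕ.* ∑ (allFin 1) (λ j → 1 ℕ.* [ 0 ℕ.<? d ]) ℕ.≤ 2 ℕ.* 1 ℕ.* d
      geometric d = ℕ.≤-trans (ℕ.≤-reflexive (simplify [ 0 ℕ.<? d ])) (ℕ.≤-trans ([]≤ (0 ℕ.<? d) (λ 0<d → 0<d)) (ℕ.m≤n*m d 2))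
        where
        simplify : ∀ x → 1 ℕ.* (1 ℕ.* x ℕ.+ 0) ≡ x
        simplify = solve-∀
      balanced : (j : Fin 1) → n ℕ.+ ((16 ℕ.* 1 ℕ.+ 16) ℕ.* (n ℕ.∸ n ℕ.* 1) ℕ.+ 16 ℕ.* 1 ℕ.* 1) ℕ.≤ 16 ℕ.* 1 ℕ.* n
      balanced j = begin
        n ℕ.+ (32 ℕ.* (n ℕ.∸ n ℕ.* 1) ℕ.+ 16)
          ≡⟨ ≡.cong (λ x → n ℕ.+ (32 ℕ.* x ℕ.+ 16)) (≡.trans (≡.cong (n ℕ.∸_) (ℕ.*-identityʳ n)) (ℕ.n∸n≡0 n)) ⟩
        n ℕ.+ 8 ℕ.* 2
          ≤⟨ ℕ.+-monoʳ-≤ n (ℕ.≤-trans (ℕ.*-monoʳ-≤ 8 2≤n) (ℕ.*-monoˡ-≤ n (ℕ.m≤m+n 8 7))) ⟩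
        n ℕ.+ 15 ℕ.* n ∎
        where open ℕ.≤-Reasoning

    -- A negative `φ` would make `φ * W` at most 0, against `n≤64φW` and `0 < n`.
    0≤φ : 0# ≤ φ
    0≤φ φ<0 = ≤-trans n≤64φW φW≤0 (<-resp refl (reflexive (≡.cong fromNat (simplify n))) 0<n)
      where
      simplify : ∀ n → n ≡ 1 ℕ.* 1 ℕ.* (1 ℕ.* n)
      simplify = solve-∀
      φW≤0 : fromNat (16 ℕ.* (2 ℕ.* 1) ℕ.* 2) * (φ * W) ≤ 0#
      φW≤0 = ≤-respʳ (zeroʳ _) (*-monoʳ-≤ (0≤fromNat (16 ℕ.* (2 ℕ.* 1) ℕ.* 2)) (≤-respʳ (zeroˡ W) (*-monoˡ-≤ 0≤W (<⇒≤ φ<0))))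

    -- The step from weight to lightness: `W ≤ n` may replace `W` beside `φ` because `0 ≤ φ`.
    cancel-n : ∀ k J {C} → fromNat (k ℕ.* k ℕ.* (J ℕ.* n)) ≤ fromNat C * (φ * W) →
               fromNat (k ℕ.* k ℕ.* J) ≤ fromNat C * φ
    cancel-n k J {C} h = *-cancelˡ-≤ 0<n (begin
      fromNat n * fromNat (k ℕ.* k ℕ.* J)     ≈⟨ fromNat-* n (k ℕ.* k ℕ.* J) ⟨
      fromNat (n ℕ.* (k ℕ.* k ℕ.* J))         ≡⟨ ≡.cong fromNat (regroup n k J) ⟩
      fromNat (k ℕ.* k ℕ.* (J ℕ.* n))         ≤⟨ h ⟩
      fromNat C * (φ * W)                     ≤⟨ *-monoʳ-≤ (0≤fromNat C) (*-monoʳ-≤ 0≤φ W≤n) ⟩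
      fromNat C * (φ * fromNat n)             ≈⟨ solve 3 (λ c f n → c :* (f :* n) := n :* (c :* f)) refl (fromNat C) φ (fromNat n) ⟩
      fromNat n * (fromNat C * φ)             ∎)
      where
      open ≤-Reasoning
      regroup : ∀ n k J → n ℕ.* (k ℕ.* k ℕ.* J) ≡ k ℕ.* k ℕ.* (J ℕ.* n)
      regroup = solve-∀

    combine : ∀ a {x b y c} → fromNat x ≤ fromNat b * φ → fromNat y ≤ fromNat c * φ →
              fromNat (a ℕ.* x ℕ.+ y) ≤ fromNat (a ℕ.* b ℕ.+ c) * φ
    combine a {x} {b} {y} {c} x≤bφ y≤cφ = begin
      fromNat (a ℕ.* x ℕ.+ y)                        ≈⟨ trans (fromNat-+ (a ℕ.* x) y) (+-congʳ (fromNat-* a x)) ⟩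
      fromNat a * fromNat x + fromNat y              ≤⟨ +-mono-≤ (*-monoʳ-≤ (0≤fromNat a) x≤bφ) y≤cφ ⟩
      fromNat a * (fromNat b * φ) + fromNat c * φ    ≈⟨ solve 4 (λ a b c f → a :* (b :* f) :+ c :* f := (a :* b :+ c) :* f) refl (fromNat a) (fromNat b) (fromNat c) φ ⟩
      (fromNat a * fromNat b + fromNat c) * φ        ≈⟨ *-congʳ (trans (fromNat-+ (a ℕ.* b) c) (+-congʳ (fromNat-* a b))) ⟨
      fromNat (a ℕ.* b ℕ.+ c) * φ                    ∎
      where open ≤-Reasoning

    denseWitness : 1# ≤ fromNat 32 * ν → Witness n ν φ
    denseWitness 1≤32ν with scaleCount 64 n
    ... | J , fit , n<64*2^J = record
      -- A scale needs three blocks of length `17 * 2 ^ j`. Rounding 51 up to `64 = 2 ^ 6` turns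
      -- `n < 64 * 2 ^ J` into `n < 2 ^ (6 + J)`.
      { k = 1 ; M = 6 ℕ.+ J
      ; 1≤64kν = ≤-trans 1≤32ν (*-monoˡ-≤ (<⇒≤ 0<ν) (fromNat-mono-≤ {32} {64} (ℕ.m≤m+n 32 32)))
      ; nν≤2^M = ≤-trans (*-monoʳ-≤ (0≤fromNat n) (<⇒≤ ν<1)) (≤-respˡ (sym (*-identityʳ _))
          (fromNat-mono-≤ (ℕ.≤-trans (ℕ.<⇒≤ n<64*2^J) (ℕ.≤-reflexive (≡.sym (ℕ.^-distribˡ-+-* 2 6 J))))))
      -- The 6 units in `M` that no scale provides come from six copies of `n≤64φW`;
      -- `6 * 64 + 1024 = 1408`.
      ; k²M≤φ = ≤-respˡ (reflexive (≡.cong fromNat (split J)))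
          (≤-trans (combine 6 {1 ℕ.* 1 ℕ.* 1} {64} {1 ℕ.* 1 ℕ.* J} {1024} (cancel-n 1 1 {64} n≤64φW) (cancel-n 1 J {1024} many))
            (*-monoˡ-≤ 0≤φ (fromNat-mono-≤ {1408} {2048} (ℕ.m≤m+n 1408 640))))
      }
      where
      split : ∀ J → 6 ℕ.* (1 ℕ.* 1 ℕ.* 1) ℕ.+ 1 ℕ.* 1 ℕ.* J ≡ 1 ℕ.* 1 ℕ.* (6 ℕ.+ J)
      split = solve-∀
      many : fromNat (1 ℕ.* 1 ℕ.* (J ℕ.* n)) ≤ fromNat (16 ℕ.* (2 ℕ.* 16) ℕ.* 2) * (φ * W)
      many = weight-bound D (<⇒≤ 0<ν) reliable {J = J} (λ j → dyadicScale n 1 16 (toℕ j)) 16 16 16 (dyadic-geometric n 1 16 {J})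
        (λ j → dense-balanced n (toℕ j) (fit (toℕ j) (toℕ<n j))) 16ν≤16 (proj₂ (proj₂ lightness))

    -- No additive constant arises: in `nν < 4kν * 2 ^ J` the factor `4kν` is at most 1, so the
    -- number of scales itself bounds the logarithm.
    sparseWitness : ∀ k → 1 ℕ.≤ k → fromNat (16 ℕ.* k) * ν ≤ fromNat 1 → 1# ≤ fromNat (32 ℕ.* suc k) * ν → Witness n ν φ
    sparseWitness k 1≤k 16kν≤1 1≤32[1+k]ν with scaleCount (4 ℕ.* k) n {{4k≢0}}
      where
      4k≢0 : NonZero (4 ℕ.* k)
      4k≢0 = ℕ.m*n≢0 4 k {{_}} {{ℕ.>-nonZero 1≤k}}
    ... | J , fit , n<4k2^J = record
      { k = k ; M = J
      ; 1≤64kν = ≤-trans 1≤32[1+k]ν (*-monoˡ-≤ (<⇒≤ 0<ν) (fromNat-mono-≤ (begin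
          32 ℕ.* suc k        ≤⟨ ℕ.*-monoʳ-≤ 32 (ℕ.+-monoˡ-≤ k 1≤k) ⟩
          32 ℕ.* (k ℕ.+ k)    ≡⟨ double k ⟩
          64 ℕ.* k            ∎)))
      ; nν≤2^M = nν≤2^J
      ; k²M≤φ = ≤-trans (cancel-n k J {64} many) (*-monoˡ-≤ 0≤φ (fromNat-mono-≤ {64} {2048} (ℕ.m≤m+n 64 1984)))
      }
      where
      open ℕ.≤-Reasoning
      instance
        k≢0 : NonZero k
        k≢0 = ℕ.>-nonZero 1≤k
      double : ∀ k → 32 ℕ.* (k ℕ.+ k) ≡ 64 ℕ.* k
      double = solve-∀
      nν≤2^J : fromNat n * ν ≤ fromNat (2 ℕ.^ J)
      nν≤2^J = R.begin
        fromNat n * ν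
          R.≤⟨ *-monoˡ-≤ (<⇒≤ 0<ν) (fromNat-mono-≤ (ℕ.≤-trans (ℕ.<⇒≤ n<4k2^J) (ℕ.≤-trans (ℕ.*-monoˡ-≤ (2 ℕ.^ J) (ℕ.*-monoˡ-≤ k (ℕ.m≤m+n 4 12))) (ℕ.≤-reflexive (ℕ.*-comm (16 ℕ.* k) (2 ℕ.^ J)))))) ⟩
        fromNat (2 ℕ.^ J ℕ.* (16 ℕ.* k)) * ν
          R.≈⟨ trans (*-congʳ (fromNat-* (2 ℕ.^ J) (16 ℕ.* k))) (*-assoc _ _ _) ⟩
        fromNat (2 ℕ.^ J) * (fromNat (16 ℕ.* k) * ν)
          R.≤⟨ *-monoʳ-≤ (0≤fromNat (2 ℕ.^ J)) 16kν≤1 ⟩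
        fromNat (2 ℕ.^ J) * fromNat 1
          R.≈⟨ trans (*-congˡ fromNat-1) (*-identityʳ _) ⟩
        fromNat (2 ℕ.^ J) R.∎
        where module R = ≤-Reasoning
      many : fromNat (k ℕ.* k ℕ.* (J ℕ.* n)) ≤ fromNat (16 ℕ.* (2 ℕ.* 1) ℕ.* 2) * (φ * W)
      many = weight-bound D (<⇒≤ 0<ν) reliable {J = J} (λ j → dyadicScale n k 1 (toℕ j)) 1 16 1 (dyadic-geometric n k 1 {J})
        (λ j → sparse-balanced n k (toℕ j) (fit (toℕ j) (toℕ<n j))) 16kν≤1 (proj₂ (proj₂ lightness))

    -- The thresholds 2 and 1 overlap, so cotransitivity always yields one of the two. Low at `k`
    -- and high at `k + 1` give `16kν ≤ 1` and `1 ≤ 32(k + 1)ν ≤ 64kν`.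
    LowAt HighAt : ℕ → Set
    LowAt  i = fromNat (32 ℕ.* i) * ν < fromNat 2
    HighAt i = 1# < fromNat (32 ℕ.* i) * ν

    low⊎high : ∀ i → LowAt i ⊎ HighAt i
    low⊎high i with <-cotrans 1<2 (fromNat (32 ℕ.* i) * ν)
      where
      1<2 : 1# < fromNat 2
      1<2 = <-resp (+-identityˡ 1#) (+-comm (fromNat 1) 1#) (+-monoˡ-< 1# (0<fromNat (ℕ.≤-refl {1})))
    ... | inj₁ high = inj₂ high
    ... | inj₂ low  = inj₁ low

    -- The Archimedean axiom bounds the search; the index has the form that `switch` expects when
    -- started at 1.
    eventually-high : ∃[ N ] HighAt (suc (N ℕ.+ 1))
    eventually-high with archimedean (recip ν 0<ν)
    ... | N , ρ<N = N , (begin-strict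
      1#                                       ≈⟨ trans (*-comm ν (recip ν 0<ν)) (recip-inverse 0<ν) ⟨
      ν * recip ν 0<ν                          <⟨ *-monoʳ-< 0<ν ρ<N ⟩
      ν * fromNat N                            ≤⟨ *-monoʳ-≤ (<⇒≤ 0<ν) (fromNat-mono-≤ (ℕ.≤-trans (ℕ.m≤m+n N 1) (ℕ.≤-trans (ℕ.n≤1+n (N ℕ.+ 1)) (ℕ.m≤n*m (suc (N ℕ.+ 1)) 32)))) ⟩
      ν * fromNat (32 ℕ.* suc (N ℕ.+ 1))       ≈⟨ *-comm ν _ ⟩
      fromNat (32 ℕ.* suc (N ℕ.+ 1)) * ν       ∎)
      where open ≤-Reasoning

    low⇒16kν≤1 : ∀ k → LowAt k → fromNat (16 ℕ.* k) * ν ≤ fromNat 1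
    low⇒16kν≤1 k low = *-cancelˡ-≤ (0<fromNat {2} (ℕ.s≤s ℕ.z≤n)) (begin
      fromNat 2 * (fromNat (16 ℕ.* k) * ν)     ≈⟨ trans (*-congʳ (fromNat-* 2 (16 ℕ.* k))) (*-assoc _ _ _) ⟨
      fromNat (2 ℕ.* (16 ℕ.* k)) * ν           ≡⟨ ≡.cong (λ x → fromNat x * ν) (double k) ⟩
      fromNat (32 ℕ.* k) * ν                   <⟨ low ⟩
      fromNat 2                                ≈⟨ fromNat-* 2 1 ⟩
      fromNat 2 * fromNat 1                    ∎)
      where
      open ≤-Reasoning
      double : ∀ k → 2 ℕ.* (16 ℕ.* k) ≡ 32 ℕ.* k
      double = solve-∀

    witness : Witness n ν φ
    witness = either (low⊎high 1)
      where
      either : LowAt 1 ⊎ HighAt 1 → Witness n ν φ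
      either (inj₂ high) = denseWitness (<⇒≤ high)
      either (inj₁ low)  = sparse (switch {LowAt} {HighAt} low⊎high (proj₁ eventually-high) low (proj₂ eventually-high))
        where
        sparse : ∃[ k ] 1 ℕ.≤ k × LowAt k × HighAt (suc k) → Witness n ν φ
        sparse (k , 1≤k , low , high) = sparseWitness k 1≤k (low⇒16kν≤1 k low) (<⇒≤ high)

theorem21 : (ℝ : RealNumbers) →
    let open RealNumbers ℝ
        open Spanners ℝ
    in
    ∃[ c ] (0# < c) ×
      (∀ (n : ℕ) → 2 ℕ.≤ n →
       ∀ (ν : Carrier) (0<ν : 0# < ν) → ν < 1# →
       ∀ (D : GraphDistribution n) → ObliviousReliable ν D →
       ∀ (φ : Carrier) → HasLightness D φ →
       ∀ (L : Carrier) → IsLog₂ (fromNat n * ν) L →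
       c * (recip ν 0<ν ^ 2 * L) ≤ φ)
theorem21 ℝ = recip constant 0<constant , 0<recip 0<constant ,
  λ n 2≤n ν 0<ν ν<1 D reliable φ lightness L log →
    witness⇒bound 0<ν (witness 2≤n 0<ν ν<1 D reliable lightness) log
  where
  open OrderedField ℝ using (0<recip; recip)
  open LowerBound ℝ
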